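{- Let $G=(V,E,s)$ be a connected undirected graph with source $s$, with $n$ vertices and $m$ edges. A LexDOWN ordering of $G$ can be computed in time $O(n+m\log(m))$.
   Context: A (undirected) graph with a source is a triple $(V,E,s)$ where $V$ is a finite set (of vertices), $E$ is a set of two-element subsets of $V$ (edges), and $s\in V$. The neighborhood of $v$ is $N(v)=\{w\mid\{v,w\}\in E\}$. The graph is connected if every pair of distinct vertices is joined by a path. Lexicographic order on words: $\mathbf a=a_1\dots a_p$ is smaller than $\mathbf b=b_1\dots b_q$ if there is $0\le i\le\min(p,q)$ such that $a_j=b_j$ for all $1\le j\le i$ and either $i=p<q$ or ($i<\min(p,q)$ and $a_{i+1}<b_{i+1}$). The symbol $\infty$ is larger than every integer. LexDOWN is the following (nondeterministic) search procedure on $G=(V,E,s)$ with $n=|V|$. Every vertex carries a label, which is a word; initially the label of every vertex is the empty word, except the label of $s$, which is the one-letter word $\infty$. All vertices are initially unnumbered. For $i=1,\dots,n$: choose an unnumbered vertex $v$ whose label is lexicographically maximal among the labels of unnumbered vertices (ties broken arbitrarily); set $\sigma[i]:=v$ (so $v$ becomes numbered); then for every unnumbered $w\in N(v)$, prepend $n-i$ to the label of $w$ (i.e. add it at the front). The output is $\sigma$. A LexDOWN ordering of $G$ is any possible output $\sigma$ of this procedure on $G$. Computation model: vertices are $v_1,\dots,v_n$, and the graph is given as an array of size $n$ whose $i$-th entry is the (doubly linked) list of neighbors of $v_i$. Integers of absolute value at most $\max(|V|,2|E|)$ can be assigned, incremented and compared in constant time. Arrays are created in time linear in their size, with constant-time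 read and write of entries. Doubly linked lists support constant-time access to the first and last node, insertion at either end, access to the predecessor, successor and value of a node, insertion before or after a given node, and removal of a given node; a list of $k$ nodes with constant-time comparisons can be sorted in time $O(k\log k)$. By convention $m\log m=0$ when $m=0$. -}

module Defs where

open import Data.Bool.Base as Bool using (Bool; true; false; if_then_else_)
open import Data.Bool.Properties using () renaming (_≟_ to _≟ᵇ_)
open import Data.Fin.Base using (Fin; toℕ; fromℕ<)
open import Data.Fin.Properties using () renaming (_≟_ to _≟ᶠ_)
open import Data.Fin.Subset using (Subset; ⁅_⁆; _∪_; ∣_∣)
open import Data.Integer.Base as ℤ using (ℤ; +_)
import Data.Integer.Properties as ℤ
open import Data.List.Base as List using (List; []; _∷_; _++_; _∷ʳ_; length; map; upTo; zip)
open import Data.List.Membership.Propositional using (_∈_)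
import Data.List.Membership.DecPropositional as DecMembership
open import Data.List.Relation.Binary.Lex.Strict using (Lex-<)
open import Data.List.Relation.Unary.All using (All)
open import Data.List.Relation.Unary.Unique.Propositional using (Unique)
import Data.List.Sort as Sort
open import Data.Maybe.Base using (Maybe; just; nothing)
open import Data.Nat.Base using (ℕ; suc; _+_; _*_; _∸_; _⊔_; _≤_; _<_; _≡ᵇ_)
open import Data.Nat.Logarithm using (⌈log₂_⌉)
open import Data.Nat.Properties using (_<?_)
open import Data.Product.Base using (Σ; ∃-syntax; _×_; _,_; proj₂)
open import Data.Vec.Base as Vec using (Vec)
import Data.Vec.Membership.DecPropositional as DecVecMembership
import Data.Vec.Properties as Vec
open import Function.Base using (_∘_)
open import Function.Bundles using (_⇔_)
open import Relation.Binary.Construct.Add.Supremum.Strict {A = ℕ} _<_ using (_<⁺_)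
open import Relation.Binary.Construct.Closure.ReflexiveTransitive using (Star)
import Relation.Binary.Construct.On as On
open import Relation.Binary.PropositionalEquality.Core using (_≡_; _≢_)
open import Relation.Nullary.Construct.Add.Supremum using (_⁺; ⊤⁺; [_])
open import Relation.Nullary.Decidable.Core using (Dec; yes; no; does; _×-dec_; ¬?)
open import Relation.Nullary.Negation.Core using (¬_)

-- The vertex set is Fin n; the set of edges is a duplicate-free list.
record Graph (n : ℕ) : Set where
  field
    edges    : List (Subset n)
    edges-2  : All (λ e → ∣ e ∣ ≡ 2) edges
    edges-≢  : Unique edges
    source   : Fin n

  #edges : ℕ
  #edges = length edges

module _ {n : ℕ} (G : Graph n) where
  open Graph G

  Adjacent : Fin n → Fin n → Set
  Adjacent v w = (⁅ v ⁆ ∪ ⁅ w ⁆) ∈ edges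

  adjacent? : ∀ v w → Dec (Adjacent v w)
  adjacent? v w = (⁅ v ⁆ ∪ ⁅ w ⁆) ∈? edges
    where open DecMembership (Vec.≡-dec _≟ᵇ_) using (_∈?_)

  Connected : Set
  Connected = ∀ v w → v ≢ w → Star Adjacent v w

-- Letters are natural numbers, with ⊤⁺ in the role of ∞.
Label : Set
Label = List (ℕ ⁺)

infix 4 _≺_

_≺_ : Label → Label → Set
_≺_ = Lex-< _≡_ _<⁺_

module LexDOWN {n : ℕ} (G : Graph n) where
  open Graph G
  open DecVecMembership (_≟ᶠ_ {n}) public using (_∉_; _∈?_)

  Labelling : Set
  Labelling = Fin n → Label

  initial : Labelling
  initial v = if does (v ≟ᶠ source) then ⊤⁺ ∷ [] else []

  -- The labelling after v has been numbered in iteration i; σ lists the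
  -- numbered vertices, v included.
  relabel : (i : ℕ) → Fin n → Vec (Fin n) i → Labelling → Labelling
  relabel i v σ ℓ w =
    if does (adjacent? G v w ×-dec ¬? (w ∈? σ)) then [ n ∸ i ] ∷ ℓ w else ℓ w

  -- Run i ℓ σ: the procedure can complete i iterations in such a way that
  -- the labels are ℓ and the vertices numbered so far are, in order, σ.
  data Run : (i : ℕ) → Labelling → Vec (Fin n) i → Set where
    start  : Run 0 initial Vec.[]
    number : ∀ {i ℓ σ} → Run i ℓ σ →
             (v : Fin n) → v ∉ σ →
             (∀ w → w ∉ σ → ¬ (ℓ v ≺ ℓ w)) →
             Run (suc i) (relabel (suc i) v (σ Vec.∷ʳ v) ℓ) (σ Vec.∷ʳ v)

  IsOrdering : Vec (Fin n) n → Set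
  IsOrdering σ = ∃[ ℓ ] Run n ℓ σ

-- A register holds an integer, a reference to an array, to a list or to
-- a node of a list, or nil. A node is referred to by its list and by a key
-- which is unique within that list; programs have no access to the key.
data Val : Set where
  int  : ℤ → Val
  arr  : ℕ → Val
  list : ℕ → Val
  node : ℕ → ℕ → Val
  nil  : Val

infixl 7 _at_
infix  6 _≤ᵗ_ _≡ᵗ_
infix  5 _:=_
infixr 4 _⨟_

data Exp : Set where
  var    : ℕ → Exp
  lit    : ℤ → Exp
  nil    : Exp
  inc    : Exp → Exp
  _at_   : Exp → Exp → Exp
  first  : Exp → Exp
  last   : Exp → Exp
  next   : Exp → Exp
  prev   : Exp → Exp
  value  : Exp → Exp

data Test : Set where
  _≤ᵗ_  : Exp → Exp → Test
  _≡ᵗ_  : Exp → Exp → Test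
  isNil : Exp → Test
  not   : Test → Test

data Cmd : Set where
  skip         : Cmd
  _:=_         : ℕ → Exp → Cmd
  newArray     : ℕ → (size init : Exp) → Cmd
  write        : (array index : Exp) → Exp → Cmd
  newList      : ℕ → Cmd
  pushFront    : (list : Exp) → Exp → Cmd
  pushBack     : (list : Exp) → Exp → Cmd
  insertBefore : (node : Exp) → Exp → Cmd
  insertAfter  : (node : Exp) → Exp → Cmd
  remove       : (node : Exp) → Cmd
  -- sort l x e sorts l by the key e, in which x stands for the value of
  -- the node.
  sort         : (list : Exp) → ℕ → (key : Exp) → Cmd
  _⨟_          : Cmd → Cmd → Cmd
  cond         : Test → Cmd → Cmd → Cmd
  while        : Test → Cmd → Cmd

-- Every constructor of an expression or a test is one unit of time.

size : Exp → ℕ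
size (var _)   = 1
size (lit _)   = 1
size nil       = 1
size (inc e)   = suc (size e)
size (e at e′) = suc (size e + size e′)
size (first e) = suc (size e)
size (last e)  = suc (size e)
size (next e)  = suc (size e)
size (prev e)  = suc (size e)
size (value e) = suc (size e)

sizeᵗ : Test → ℕ
sizeᵗ (e ≤ᵗ e′) = suc (size e + size e′)
sizeᵗ (e ≡ᵗ e′) = suc (size e + size e′)
sizeᵗ (isNil e) = suc (size e)
sizeᵗ (not b)   = suc (sizeᵗ b)

Node : Set
Node = ℕ × Val

infixl 6 _[_↦_]

_[_↦_] : {A : Set} → (ℕ → A) → ℕ → A → ℕ → A
(f [ x ↦ a ]) y = if y ≡ᵇ x then a else f y

-- References and node keys from fresh on are unused.
record State : Set where
  constructor state
  field
    reg   : ℕ → Val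
    arrs  : ℕ → Σ ℕ (Vec Val)
    lists : ℕ → List Node
    fresh : ℕ

open State public

setReg : ℕ → Val → State → State
setReg x v s = record s { reg = reg s [ x ↦ v ] }

setArr : ℕ → Σ ℕ (Vec Val) → State → State
setArr a c s = record s { arrs = arrs s [ a ↦ c ] }

setList : ℕ → List Node → State → State
setList l ns s = record s { lists = lists s [ l ↦ ns ] }

tick : State → State
tick s = record s { fresh = suc (fresh s) }

nodeRef : ℕ → Maybe Node → Val
nodeRef l (just (k , _)) = node l k
nodeRef l nothing        = nil

sortBy : (Val → ℤ) → List Node → List Node
sortBy key = Sort.sort (On.decTotalOrder ℤ.≤-decTotalOrder (key ∘ proj₂))

-- Only integers of absolute value at most B are available. An operation to
-- which no rule applies is a fault: execution does not halt.
module Execution (B : ℕ) where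

  infix 3 _⊢_⇓_ _⊢_⇓ᵗ_ _⊢_⇓[_]_

  data _⊢_⇓_ (s : State) : Exp → Val → Set where

    ⇓var   : ∀ {x} → s ⊢ var x ⇓ reg s x

    ⇓lit   : ∀ {z} → ℤ.∣ z ∣ ≤ B → s ⊢ lit z ⇓ int z

    ⇓nil   : s ⊢ nil ⇓ nil

    ⇓inc   : ∀ {e z} → s ⊢ e ⇓ int z → ℤ.∣ ℤ.suc z ∣ ≤ B →
             s ⊢ inc e ⇓ int (ℤ.suc z)

    ⇓at    : ∀ {e e′ a n vs} {i : Fin n} →
             s ⊢ e ⇓ arr a → arrs s a ≡ (n , vs) →
             s ⊢ e′ ⇓ int (+ toℕ i) →
             s ⊢ e at e′ ⇓ Vec.lookup vs i

    ⇓first : ∀ {e l} → s ⊢ e ⇓ list l →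
             s ⊢ first e ⇓ nodeRef l (List.head (lists s l))

    ⇓last  : ∀ {e l} → s ⊢ e ⇓ list l →
             s ⊢ last e ⇓ nodeRef l (List.last (lists s l))

    ⇓next  : ∀ {e l k v ns ns′} →
             s ⊢ e ⇓ node l k → lists s l ≡ ns ++ (k , v) ∷ ns′ →
             s ⊢ next e ⇓ nodeRef l (List.head ns′)

    ⇓prev  : ∀ {e l k v ns ns′} →
             s ⊢ e ⇓ node l k → lists s l ≡ ns ++ (k , v) ∷ ns′ →
             s ⊢ prev e ⇓ nodeRef l (List.last ns)

    ⇓value : ∀ {e l k v ns ns′} →
             s ⊢ e ⇓ node l k → lists s l ≡ ns ++ (k , v) ∷ ns′ →
             s ⊢ value e ⇓ v

  null : Val → Bool
  null nil = true
  null _   = false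

  data _⊢_⇓ᵗ_ (s : State) : Test → Bool → Set where

    ⇓≤     : ∀ {e e′ y z} → s ⊢ e ⇓ int y → s ⊢ e′ ⇓ int z →
             s ⊢ e ≤ᵗ e′ ⇓ᵗ does (y ℤ.≤? z)

    ⇓≡     : ∀ {e e′ y z} → s ⊢ e ⇓ int y → s ⊢ e′ ⇓ int z →
             s ⊢ e ≡ᵗ e′ ⇓ᵗ does (y ℤ.≟ z)

    ⇓isNil : ∀ {e v} → s ⊢ e ⇓ v → s ⊢ isNil e ⇓ᵗ null v

    ⇓not   : ∀ {b p} → s ⊢ b ⇓ᵗ p → s ⊢ not b ⇓ᵗ Bool.not p

  -- s ⊢ c ⇓[ t ] s′: started in s, c halts in s′ after time t.
  data _⊢_⇓[_]_ (s : State) : Cmd → ℕ → State → Set where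

    ⇓skip : s ⊢ skip ⇓[ 1 ] s

    ⇓:= : ∀ {x e v} → s ⊢ e ⇓ v →
          s ⊢ x := e ⇓[ suc (size e) ] setReg x v s

    ⇓newArray : ∀ {x e e′ k v} → s ⊢ e ⇓ int (+ k) → s ⊢ e′ ⇓ v →
      s ⊢ newArray x e e′ ⇓[ suc (size e + size e′ + k) ]
        tick (setReg x (arr (fresh s)) (setArr (fresh s) (k , Vec.replicate k v) s))

    ⇓write : ∀ {e e′ e″ a n vs v} {i : Fin n} →
      s ⊢ e ⇓ arr a → arrs s a ≡ (n , vs) → s ⊢ e′ ⇓ int (+ toℕ i) → s ⊢ e″ ⇓ v →
      s ⊢ write e e′ e″ ⇓[ suc (size e + size e′ + size e″) ]
        setArr a (n , vs Vec.[ i ]≔ v) s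

    ⇓newList : ∀ {x} →
      s ⊢ newList x ⇓[ 1 ]
        tick (setReg x (list (fresh s)) (setList (fresh s) [] s))

    ⇓pushFront : ∀ {e e′ l v} → s ⊢ e ⇓ list l → s ⊢ e′ ⇓ v →
      s ⊢ pushFront e e′ ⇓[ suc (size e + size e′) ]
        tick (setList l ((fresh s , v) ∷ lists s l) s)

    ⇓pushBack : ∀ {e e′ l v} → s ⊢ e ⇓ list l → s ⊢ e′ ⇓ v →
      s ⊢ pushBack e e′ ⇓[ suc (size e + size e′) ]
        tick (setList l (lists s l ∷ʳ (fresh s , v)) s)

    ⇓insertBefore : ∀ {e e′ l k u v ns ns′} →
      s ⊢ e ⇓ node l k → lists s l ≡ ns ++ (k , u) ∷ ns′ → s ⊢ e′ ⇓ v →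
      s ⊢ insertBefore e e′ ⇓[ suc (size e + size e′) ]
        tick (setList l (ns ++ (fresh s , v) ∷ (k , u) ∷ ns′) s)

    ⇓insertAfter : ∀ {e e′ l k u v ns ns′} →
      s ⊢ e ⇓ node l k → lists s l ≡ ns ++ (k , u) ∷ ns′ → s ⊢ e′ ⇓ v →
      s ⊢ insertAfter e e′ ⇓[ suc (size e + size e′) ]
        tick (setList l (ns ++ (k , u) ∷ (fresh s , v) ∷ ns′) s)

    ⇓remove : ∀ {e l k u ns ns′} →
      s ⊢ e ⇓ node l k → lists s l ≡ ns ++ (k , u) ∷ ns′ →
      s ⊢ remove e ⇓[ suc (size e) ] setList l (ns ++ ns′) s

    -- key is determined on the values in the list, hence so is the result. The
    -- time is k ⌈log₂ k⌉ comparisons of keys for a list of k nodes.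
    ⇓sort : ∀ {e x e′ l} → s ⊢ e ⇓ list l → (key : Val → ℤ) →
      (∀ {k v} → (k , v) ∈ lists s l → setReg x v s ⊢ e′ ⇓ int (key v)) →
      s ⊢ sort e x e′
        ⇓[ suc (size e + size e′ * (length (lists s l) * ⌈log₂ length (lists s l) ⌉)) ]
        setList l (sortBy key (lists s l)) s

    ⇓⨟ : ∀ {c c′ t t′ s′ s″} → s ⊢ c ⇓[ t ] s′ → s′ ⊢ c′ ⇓[ t′ ] s″ →
      s ⊢ c ⨟ c′ ⇓[ t + t′ ] s″

    ⇓cond-true : ∀ {b c c′ t s′} → s ⊢ b ⇓ᵗ true → s ⊢ c ⇓[ t ] s′ →
      s ⊢ cond b c c′ ⇓[ suc (sizeᵗ b + t) ] s′

    ⇓cond-false : ∀ {b c c′ t s′} → s ⊢ b ⇓ᵗ false → s ⊢ c′ ⇓[ t ] s′ →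
      s ⊢ cond b c c′ ⇓[ suc (sizeᵗ b + t) ] s′

    ⇓while-true : ∀ {b c t t′ s′ s″} →
      s ⊢ b ⇓ᵗ true → s ⊢ c ⇓[ t ] s′ → s′ ⊢ while b c ⇓[ t′ ] s″ →
      s ⊢ while b c ⇓[ suc (sizeᵗ b + t + t′) ] s″

    ⇓while-false : ∀ {b c} → s ⊢ b ⇓ᵗ false →
      s ⊢ while b c ⇓[ suc (sizeᵗ b) ] s

record AdjacencyLists {n : ℕ} (G : Graph n) : Set where
  field
    nbrs   : Fin n → List (Fin n)
    nbrs-≢ : ∀ v → Unique (nbrs v)
    nbrs-∈ : ∀ v w → w ∈ nbrs v ⇔ Adjacent G v w

vertex : ∀ {n} → Fin n → Val
vertex v = int (+ toℕ v)

-- Register 0 holds the array of adjacency lists, register 1 the number of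
-- vertices and register 2 the source. Arrays are indexed from 0.
input : ∀ {n} (G : Graph n) → AdjacencyLists G → State
input {n} G A = state reg₀ arrs₀ lists₀ n
  where
  open AdjacencyLists A

  reg₀ : ℕ → Val
  reg₀ 0 = arr 0
  reg₀ 1 = int (+ n)
  reg₀ 2 = vertex (Graph.source G)
  reg₀ _ = nil

  arrs₀ : ℕ → Σ ℕ (Vec Val)
  arrs₀ 0 = n , Vec.tabulate (λ v → list (toℕ v))
  arrs₀ _ = 0 , Vec.[]

  nodes : List (Fin n) → List Node
  nodes vs = zip (upTo (length vs)) (map vertex vs)

  lists₀ : ℕ → List Node
  lists₀ l with l <? n
  ... | yes l<n = nodes (nbrs (fromℕ< l<n))
  ... | no  _   = []

-- On exit, register 0 holds the array of the vertices in the order σ.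
Output : ∀ {n} → Vec (Fin n) n → State → Set
Output {n} σ s = ∃[ a ] reg s 0 ≡ arr a × arrs s a ≡ (n , Vec.map vertex σ)

Computes : ∀ {n} (p : Cmd) (G : Graph n) → AdjacencyLists G → Vec (Fin n) n → ℕ → Set
Computes {n} p G A σ t = ∃[ s ] (input G A ⊢ p ⇓[ t ] s × Output σ s)
  where open Execution (n ⊔ 2 * Graph.#edges G)

module Submission where

-- In LexDOWN a new letter is smaller than all letters in use, and it is put in
-- front. So among the unnumbered vertices with nonempty labels, the relabelled
-- neighbours of the vertex just numbered drop below all others; they keep their
-- relative order, and those that had the empty label come last among them.
-- A queue therefore holds the vertices in order of decreasing label: to number a
-- vertex, sort its unnumbered neighbours by their position in the queue and
-- append them again. Their old entries are left behind; an entry is recognized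
-- as stale because each vertex records the index of its latest one. There are at
-- most 2m + 1 entries, by the handshake lemma, and numbering a vertex of degree d
-- costs O(1 + d + d log d), which adds up to O(n + m + m log m); the summand m is
-- absorbed because m ≤ n + m ⌊log₂ m ⌋.

open import Data.Bool.Base using (true; false; if_then_else_)
open import Data.Empty using (⊥)
open import Data.Fin.Base using (Fin; zero; suc; toℕ; fromℕ<)
open import Data.Fin.Properties using (toℕ<n; toℕ-injective; toℕ-fromℕ<; fromℕ<-toℕ) renaming (_≟_ to _≟ᶠ_)
open import Data.Fin.Subset as Subset using (Subset; ⁅_⁆; _∪_; ∣_∣; inside; outside)
import Data.Fin.Subset.Properties as Subset
open import Data.Integer.Base as ℤ using (ℤ; +_; -[1+_])
import Data.Integer.Properties as ℤ
open import Data.List.Base as List using (List; []; _∷_; _++_; length; map; filter)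
import Data.List.Membership.DecPropositional as DecMembership
open import Data.List.Membership.Propositional using (_∈_; _∉_)
open import Data.List.Membership.Propositional.Properties
  using (∈-∃++; ∈-++⁺ˡ; ∈-++⁺ʳ; ∈-++⁻; ∈-filter⁺; ∈-filter⁻; ∈-map⁺; ∈-map⁻)
open import Data.List.Properties
  using (length-++; length-map; length-filter; length-upTo; map-++; ++-assoc; ++-identityʳ;
         filter-≐; filter-++; filter-accept; filter-reject)
open import Data.List.Relation.Binary.Lex.Strict using (this; next; xs≮[])
open import Data.List.Relation.Binary.Permutation.Propositional using (_↭_; ↭-sym; ↭⇒↭ₛ)
open import Data.List.Relation.Binary.Permutation.Propositional.Properties
  using (∈-resp-↭; ↭-length; map⁺; ↭-map-inv)
import Data.List.Relation.Binary.Permutation.Setoid.Properties as Permutation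
open import Data.List.Relation.Binary.Subset.Propositional using (_⊆_)
open import Data.List.Relation.Unary.All as All using (All; []; _∷_)
open import Data.List.Relation.Unary.AllPairs as AllPairs using (AllPairs; []; _∷_)
import Data.List.Relation.Unary.AllPairs.Properties as AllPairs
open import Data.List.Relation.Unary.Any using (here; there)
import Data.List.Relation.Unary.Sorted.TotalOrder.Properties as Sorted
open import Data.List.Relation.Unary.Unique.Propositional using (Unique)
import Data.List.Relation.Unary.Unique.Propositional.Properties as Unique
import Data.List.Sort as Sort
open import Data.Nat.Base
open import Data.Nat.Induction using (Acc; acc; <-wellFounded)
open import Data.Nat.Logarithm
  using (⌊log₂_⌋; ⌈log₂_⌉; ⌊log₂⌋-mono-≤; ⌈log₂⌉-mono-≤; ⌈log₂2*n⌉≡1+⌈log₂n⌉)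
open import Data.Nat.Logarithm.Core using (⌊log2⌋; ⌈log2⌉)
open import Data.Nat.Properties
open import Data.Nat.Tactic.RingSolver using (solve-∀)
open import Data.Product.Base using (Σ; ∃-syntax; _×_; _,_; proj₁; proj₂)
open import Data.Sum.Base using (_⊎_; inj₁; inj₂)
open import Data.Vec.Base as Vec using (Vec; lookup; _[_]≔_; _∷ʳ_)
open import Data.Vec.Membership.Propositional using () renaming (_∈_ to _∈ᵛ_; _∉_ to _∉ᵛ_)
open import Data.Vec.Properties
  using (lookup∘update; lookup∘update′; lookup-map; lookup-replicate; lookup∘tabulate; map-[]≔;
         map-replicate; []≔-lookup; tabulate∘lookup; tabulate-cong)
import Data.Vec.Relation.Unary.Any as VecAny
open import Function.Base using (_∘_)
open import Function.Bundles using (Equivalence)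
open import Relation.Binary.Bundles using (DecTotalOrder)
open import Relation.Binary.Construct.Add.Supremum.Strict {A = ℕ} _<_ using ([_])
open import Relation.Binary.Construct.Closure.ReflexiveTransitive using (Star; ε; _◅_)
import Relation.Binary.Construct.On as On
open import Relation.Binary.Definitions using (tri<; tri≈; tri>)
open import Relation.Binary.PropositionalEquality hiding ([_])
open import Relation.Nullary.Construct.Add.Supremum using (⊤⁺; [_])
open import Relation.Nullary.Decidable using (does; yes; no; ¬?; dec-true; dec-false; _×-dec_)
open import Relation.Nullary.Negation.Core using (¬_; contradiction)
open import Relation.Unary using (Decidable)

open import Algebra.Properties.CommutativeMonoid.Sum +-0-commutativeMonoid
  using (sum; ∑-distrib-+; sum-cong-≗; sum-replicate-zero)

open import Defs

-- The program never computes labels. All that it keeps of them is one key per vertex, an index into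
-- the queue, and the invariant says that a smaller key never belongs to a lexicographically smaller
-- label. Vertices with empty labels have no entry, so the queue might run dry too early;
-- connectedness excludes this. The obstacle is the bound `B`, the maximum of n and 2m, on the
-- available integers: indices grow with every entry, stale ones included. The number of entries
-- made so far plus the degrees of the unnumbered vertices never increases, as a visit makes at most
-- as many entries as the vertex has neighbours. It starts at 1 + (sum of degrees), so there are at
-- most 2m + 1 entries, with indices from 0 to 2m. The same exchange of degrees for entries yields
-- termination and the amortized time. Labels are related to a functional model of the keys (`mark`,
-- `stampAll`), and the machine to that model.

-- Logarithms, finite sums and counting.

-- The ceiling recurses on the half rounded up, the floor on the half rounded down. With arguments
-- one apart both recursions descend to `⌊ k /2⌋`, so a single induction compares them.
⌈log2⌉-suc-≤ : ∀ k (a : Acc _<_ (2 + k)) (b : Acc _<_ (1 + k)) →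
               ⌈log2⌉ (2 + k) a ≤ suc (⌊log2⌋ (1 + k) b)
⌈log2⌉-suc-≤ zero    (acc _)  _        = s≤s z≤n
⌈log2⌉-suc-≤ (suc k) (acc as) (acc bs) = s≤s (⌈log2⌉-suc-≤ ⌊ k /2⌋ (as _) (bs _))

⌈log₂⌉≤1+⌊log₂⌋ : ∀ k → ⌈log₂ k ⌉ ≤ suc ⌊log₂ k ⌋
⌈log₂⌉≤1+⌊log₂⌋ zero    = z≤n
⌈log₂⌉≤1+⌊log₂⌋ (suc k) = ≤-trans (⌈log₂⌉-mono-≤ (n≤1+n (suc k))) (⌈log2⌉-suc-≤ k (<-wellFounded _) (<-wellFounded _))

sum-mono-≤ : ∀ {k} {f g : Fin k → ℕ} → (∀ i → f i ≤ g i) → sum f ≤ sum g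
sum-mono-≤ {zero}  f≤g = z≤n
sum-mono-≤ {suc k} f≤g = +-mono-≤ (f≤g zero) (sum-mono-≤ (f≤g ∘ suc))

-- Numbering a vertex sets its weight to 0; this isolates the amount that leaves the sum, the step
-- behind all amortized bounds.
sum-zeroed : ∀ {k} {f g : Fin k → ℕ} i → g i ≡ 0 → (∀ j → j ≢ i → g j ≡ f j) →
             sum f ≡ f i + sum g
sum-zeroed {f = f} {g} zero gi≡0 g≗f =
  cong (λ s → f zero + s) (trans (sum-cong-≗ (λ j → sym (g≗f (suc j) λ ()))) (cong (_+ sum (g ∘ suc)) (sym gi≡0)))
sum-zeroed {f = f} {g} (suc i) gi≡0 g≗f = begin
  f zero + sum (f ∘ suc)               ≡⟨ cong₂ _+_ (sym (g≗f zero λ ()))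
                                            (sum-zeroed i gi≡0 λ j j≢i → g≗f (suc j) λ { refl → j≢i refl }) ⟩
  g zero + (f (suc i) + sum (g ∘ suc)) ≡⟨ +-assoc (g zero) _ _ ⟨
  g zero + f (suc i) + sum (g ∘ suc)   ≡⟨ cong (_+ sum (g ∘ suc)) (+-comm (g zero) _) ⟩
  f (suc i) + g zero + sum (g ∘ suc)   ≡⟨ +-assoc (f (suc i)) _ _ ⟩
  f (suc i) + (g zero + sum (g ∘ suc)) ∎
  where open ≡-Reasoning

unique-⊆⇒length-≤ : ∀ {A : Set} {xs ys : List A} → Unique xs → xs ⊆ ys → length xs ≤ length ys
unique-⊆⇒length-≤ []            _  = z≤n
unique-⊆⇒length-≤ {xs = x ∷ xs} (x∉xs ∷ !xs) ⊆ys with ∈-∃++ (⊆ys (here refl))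
... | as , bs , refl = begin
  suc (length xs)              ≤⟨ s≤s (unique-⊆⇒length-≤ !xs ⊆as++bs) ⟩
  suc (length (as ++ bs))      ≡⟨ cong suc (length-++ as) ⟩
  suc (length as + length bs)  ≡⟨ +-suc (length as) (length bs) ⟨
  length as + suc (length bs)  ≡⟨ length-++ as ⟨
  length (as ++ x ∷ bs)        ∎
  where
  open ≤-Reasoning
  ⊆as++bs : xs ⊆ as ++ bs
  ⊆as++bs y∈xs with ∈-++⁻ as (⊆ys (there y∈xs))
  ... | inj₁ y∈as          = ∈-++⁺ˡ y∈as
  ... | inj₂ (here refl)   = contradiction refl (All.lookup x∉xs y∈xs)
  ... | inj₂ (there y∈bs)  = ∈-++⁺ʳ as y∈bs

indicator-sum : ∀ {k} (e : Subset k) → sum (λ v → if does (v Subset.∈? e) then 1 else 0) ≡ ∣ e ∣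
indicator-sum Vec.[]            = refl
indicator-sum (inside Vec.∷ e)  = cong suc (indicator-sum e)
indicator-sum (outside Vec.∷ e) = indicator-sum e

-- Double counting, one edge at a time: an edge adds its indicator function to the vertex counts,
-- and that sums to 2.
incidences : ∀ {k} {es : List (Subset k)} → All (λ e → ∣ e ∣ ≡ 2) es →
             sum (λ v → length (filter (v Subset.∈?_) es)) ≡ 2 * length es
incidences {k} [] = sum-replicate-zero k
incidences {k} {e ∷ es} (∣e∣≡2 ∷ ∣es∣≡2) = begin
  sum (λ v → length (filter (v Subset.∈?_) (e ∷ es)))
    ≡⟨ sum-cong-≗ split ⟩
  sum (λ v → (if does (v Subset.∈? e) then 1 else 0) + length (filter (v Subset.∈?_) es))
    ≡⟨ ∑-distrib-+ (λ v → if does (v Subset.∈? e) then 1 else 0) _ ⟩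
  sum (λ v → if does (v Subset.∈? e) then 1 else 0) + sum (λ v → length (filter (v Subset.∈?_) es))
    ≡⟨ cong₂ _+_ (trans (indicator-sum e) ∣e∣≡2) (incidences ∣es∣≡2) ⟩
  2 + 2 * length es
    ≡⟨ *-suc 2 (length es) ⟨
  2 * suc (length es) ∎
  where
  open ≡-Reasoning
  split : ∀ v → length (filter (v Subset.∈?_) (e ∷ es)) ≡
                (if does (v Subset.∈? e) then 1 else 0) + length (filter (v Subset.∈?_) es)
  split v with does (v Subset.∈? e)
  ... | true  = refl
  ... | false = refl

-- The handshake lemma.

module _ {n} (G : Graph n) (A : AdjacencyLists G) where
  open Graph G
  open AdjacencyLists A

  degree : Fin n → ℕ
  degree v = length (nbrs v)

  private
    edge : Fin n → Fin n → Subset n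
    edge v w = ⁅ v ⁆ ∪ ⁅ w ⁆

    edge∈ : ∀ {v w} → w ∈ nbrs v → edge v w ∈ edges
    edge∈ = Equivalence.to (nbrs-∈ _ _)

    -- Union is idempotent, so a loop would be an edge with a single element.
    no-loop : ∀ {v w} → w ∈ nbrs v → w ≢ v
    no-loop {v} v∈ refl with trans (sym (All.lookup edges-2 (edge∈ v∈)))
                                    (trans (cong ∣_∣ (Subset.∪-idem ⁅ v ⁆)) (Subset.∣⁅x⁆∣≡1 v))
    ... | ()

    edge-injective : ∀ {v w w′} → w ≢ v → edge v w ≡ edge v w′ → w ≡ w′
    edge-injective {v} {w} {w′} w≢v eq
      with Subset.x∈p∪q⁻ ⁅ v ⁆ ⁅ w′ ⁆
             (subst (w Subset.∈_) eq (Subset.x∈p∪q⁺ {p = ⁅ v ⁆} (inj₂ (Subset.x∈⁅x⁆ w))))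
    ... | inj₁ w∈v = contradiction (Subset.x∈⁅y⁆⇒x≡y v w∈v) w≢v
    ... | inj₂ w∈w′ = Subset.x∈⁅y⁆⇒x≡y w′ w∈w′

    edges-unique : ∀ {v ws} → All (_≢ v) ws → Unique ws → Unique (map (edge v) ws)
    edges-unique []           []          = []
    edges-unique (w≢v ∷ ws≢v) (w∉ws ∷ !ws) =
      All.tabulate (λ e∈ → λ { refl → absurd (∈-map⁻ _ e∈) }) ∷ edges-unique ws≢v !ws
      where
      absurd : ∃[ w′ ] (w′ ∈ _ × edge _ _ ≡ edge _ w′) → ⊥
      absurd (w′ , w′∈ , eq) = All.lookup w∉ws w′∈ (edge-injective w≢v eq)

  -- `edge v` maps the neighbours of `v` injectively to the edges containing `v`; these are then
  -- counted by `incidences`.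
  handshake : sum degree ≤ 2 * #edges
  handshake = begin
    sum degree                                        ≤⟨ sum-mono-≤ degree≤ ⟩
    sum (λ v → length (filter (v Subset.∈?_) edges))  ≡⟨ incidences edges-2 ⟩
    2 * #edges                                        ∎
    where
    open ≤-Reasoning
    degree≤ : ∀ v → degree v ≤ length (filter (v Subset.∈?_) edges)
    degree≤ v = begin
      degree v                                    ≡⟨ length-map (edge v) (nbrs v) ⟨
      length (map (edge v) (nbrs v))
        ≤⟨ unique-⊆⇒length-≤ (edges-unique (All.tabulate no-loop) (nbrs-≢ v)) incident ⟩
      length (filter (v Subset.∈?_) edges)        ∎
      where
      incident : map (edge v) (nbrs v) ⊆ filter (v Subset.∈?_) edges
      incident e∈ with ∈-map⁻ (edge v) e∈
      ... | w , w∈ , refl = ∈-filter⁺ (v Subset.∈?_) (edge∈ w∈)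
                              (Subset.x∈p∪q⁺ {q = ⁅ w ⁆} (inj₁ (Subset.x∈⁅x⁆ v)))

-- Positions in lists and vectors.

-- Positions are plain numbers: a queue index is an offset plus a position, and a position must stay
-- the same when the queue is extended at the back.
data At {A : Set} : List A → ℕ → A → Set where
  here  : ∀ {x xs} → At (x ∷ xs) 0 x
  there : ∀ {x y xs j} → At xs j x → At (y ∷ xs) (suc j) x

module _ {A : Set} where

  At-++⁺ˡ : ∀ {xs ys : List A} {j x} → At xs j x → At (xs ++ ys) j x
  At-++⁺ˡ here        = here
  At-++⁺ˡ (there pos) = there (At-++⁺ˡ pos)

  At-++⁺ʳ : ∀ (xs : List A) {ys j x} → At ys j x → At (xs ++ ys) (length xs + j) x
  At-++⁺ʳ []       pos = pos
  At-++⁺ʳ (_ ∷ xs) pos = there (At-++⁺ʳ xs pos)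

  At-< : ∀ {xs : List A} {j x} → At xs j x → j < length xs
  At-< here        = s≤s z≤n
  At-< (there pos) = s≤s (At-< pos)

  At-functional : ∀ {xs : List A} {j x y} → At xs j x → At xs j y → x ≡ y
  At-functional here        here         = refl
  At-functional (there pos) (there pos′) = At-functional pos pos′

  At⇒∈ : ∀ {xs : List A} {j x} → At xs j x → x ∈ xs
  At⇒∈ here        = here refl
  At⇒∈ (there pos) = there (At⇒∈ pos)

  ∈⇒At : ∀ {xs : List A} {x} → x ∈ xs → ∃[ j ] At xs j x
  ∈⇒At (here refl) = 0 , here
  ∈⇒At (there x∈)  with ∈⇒At x∈
  ... | j , pos = suc j , there pos

  AllPairs-At : ∀ {R : A → A → Set} {xs j k x y} → AllPairs R xs → j < k →
                At xs j x → At xs k y → R x y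
  AllPairs-At (Rx ∷ _)  _         here        (there pos′) = All.lookup Rx (At⇒∈ pos′)
  AllPairs-At (_ ∷ Rxs) (s≤s j<k) (there pos) (there pos′) = AllPairs-At Rxs j<k pos pos′

  ∈-∷ʳ⁻ : ∀ {i} {xs : Vec A i} {x y} → x ∈ᵛ (xs ∷ʳ y) → x ∈ᵛ xs ⊎ x ≡ y
  ∈-∷ʳ⁻ {xs = Vec.[]}     (VecAny.here x≡y) = inj₂ x≡y
  ∈-∷ʳ⁻ {xs = _ Vec.∷ xs} (VecAny.here x≡z) = inj₁ (VecAny.here x≡z)
  ∈-∷ʳ⁻ {xs = _ Vec.∷ xs} (VecAny.there x∈) with ∈-∷ʳ⁻ {xs = xs} x∈
  ... | inj₁ x∈xs = inj₁ (VecAny.there x∈xs)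
  ... | inj₂ x≡y  = inj₂ x≡y

  ∈-∷ʳ⁺ˡ : ∀ {i} {xs : Vec A i} {x y} → x ∈ᵛ xs → x ∈ᵛ (xs ∷ʳ y)
  ∈-∷ʳ⁺ˡ (VecAny.here x≡z) = VecAny.here x≡z
  ∈-∷ʳ⁺ˡ (VecAny.there x∈) = VecAny.there (∈-∷ʳ⁺ˡ x∈)

  ∈-∷ʳ⁺ʳ : ∀ {i} (xs : Vec A i) {y} → y ∈ᵛ (xs ∷ʳ y)
  ∈-∷ʳ⁺ʳ Vec.[]       = VecAny.here refl
  ∈-∷ʳ⁺ʳ (_ Vec.∷ xs) = VecAny.there (∈-∷ʳ⁺ʳ xs)

-- Lexicographic order of labels.

≺-irrefl : ∀ {xs} → ¬ xs ≺ xs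
≺-irrefl (this [ b<b ]) = <-irrefl refl b<b
≺-irrefl (next _ xs≺xs) = ≺-irrefl xs≺xs

∷-⊀ : ∀ {b xs ys} → ¬ xs ≺ ys → ¬ ([ b ] ∷ xs) ≺ ([ b ] ∷ ys)
∷-⊀ xs⊀ys (this [ b<b ]) = <-irrefl refl b<b
∷-⊀ xs⊀ys (next _ xs≺ys) = xs⊀ys xs≺ys

-- Only the first letter has to be bounded, as a comparison with a label that starts with a smaller
-- letter is decided there. For ∞ the bound is vacuous.
Above : ℕ → Label → Set
Above b xs = ∃[ a ] ∃[ ys ] (xs ≡ a ∷ ys × ∀ {c} → a ≡ [ c ] → b ≤ c)

Above-⊀ : ∀ {b c xs ys} → c < b → Above b xs → ¬ xs ≺ ([ c ] ∷ ys)
Above-⊀ c<b (_ , _ , refl , b≤) (this [ a<c ]) = <-asym c<b (≤-<-trans (b≤ refl) a<c)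
Above-⊀ c<b (_ , _ , refl , b≤) (next refl _)  = <⇒≱ c<b (b≤ refl)

-- The key array as a functional model.

data Key : Set where
  unlabelled : Key
  numbered   : Key
  stamp      : ℕ → Key

stamp-injective : ∀ {t t′} → stamp t ≡ stamp t′ → t ≡ t′
stamp-injective refl = refl

numbered? : Decidable (_≡ numbered)
numbered? unlabelled = no λ ()
numbered? numbered   = yes refl
numbered? (stamp _)  = no λ ()

weight : Key → ℕ → ℕ
weight numbered _ = 0
weight _        x = x

weight-live : ∀ {k} x → k ≢ numbered → weight k x ≡ x
weight-live {unlabelled} _ _ = refl
weight-live {numbered}   _ ≢ = contradiction refl ≢
weight-live {stamp _}    _ _ = refl

-- The next unused index b is a provisional key, which sorts the vertices that
-- had no label behind those already in the queue.
touch : ℕ → Key → Key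
touch b unlabelled = stamp b
touch b k          = k

touch-idem : ∀ b k → touch b (touch b k) ≡ touch b k
touch-idem b unlabelled = refl
touch-idem b numbered   = refl
touch-idem b (stamp _)  = refl

touch-numbered : ∀ {b k} → touch b k ≡ numbered → k ≡ numbered
touch-numbered {k = numbered} _ = refl

touch-known : ∀ b k → touch b k ≢ unlabelled
touch-known b unlabelled ()
touch-known b numbered   ()
touch-known b (stamp _)  ()

touch-live : ∀ b {k} → k ≢ numbered → ∃[ t ] touch b k ≡ stamp t
touch-live b {unlabelled} _ = b , refl
touch-live b {numbered}   ≢ = contradiction refl ≢
touch-live b {stamp t}    _ = t , refl

module _ {n : ℕ} where

  Keys : Set
  Keys = Vec Key n

  -- The budget not yet spent: with the constant 1 it counts the unnumbered vertices, with degrees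
  -- it bounds the entries to come, with costs the time to come.
  remaining : (Fin n → ℕ) → Keys → ℕ
  remaining f κ = sum (λ v → weight (lookup κ v) (f v))

  active : Keys → List (Fin n) → List (Fin n)
  active κ = filter (λ w → ¬? (numbered? (lookup κ w)))

  -- The effect of the loop `collect` on the keys; `stampAll` is that of `enqueueBatch`.
  mark : ℕ → Keys → List (Fin n) → Keys
  mark b κ []       = κ
  mark b κ (w ∷ ws) = mark b (κ [ w ]≔ touch b (lookup κ w)) ws

  stampAll : ℕ → Keys → List (Fin n) → Keys
  stampAll b κ []       = κ
  stampAll b κ (w ∷ ws) = stampAll (suc b) (κ [ w ]≔ stamp b) ws

  Earlier : Keys → Fin n → Fin n → Set
  Earlier κ x y = ∀ {t t′} → lookup κ x ≡ stamp t → lookup κ y ≡ stamp t′ → t ≤ t′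

  mark-fixed : ∀ {b κ x} ws → touch b (lookup κ x) ≡ lookup κ x →
               lookup (mark b κ ws) x ≡ lookup κ x
  mark-fixed []                   _     = refl
  mark-fixed {b} {κ} {x} (w ∷ ws) fixed =
    trans (mark-fixed ws (trans (cong (touch b) same) (trans fixed (sym same)))) same
    where
    same : lookup (κ [ w ]≔ touch b (lookup κ w)) x ≡ lookup κ x
    same with x ≟ᶠ w
    ... | yes refl = trans (lookup∘update w κ _) fixed
    ... | no x≢w   = lookup∘update′ x≢w κ _

  mark-∉ : ∀ {b κ x} ws → x ∉ ws → lookup (mark b κ ws) x ≡ lookup κ x
  mark-∉         []       _   = refl
  mark-∉ {κ = κ} (w ∷ ws) x∉ =
    trans (mark-∉ ws (x∉ ∘ there)) (lookup∘update′ (λ { refl → x∉ (here refl) }) κ _)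

  -- `touch` is idempotent, so a further occurrence of `x` in the list changes nothing.
  mark-∈ : ∀ {b κ x ws} → x ∈ ws → lookup (mark b κ ws) x ≡ touch b (lookup κ x)
  mark-∈ {b} {κ} {x} {_ ∷ ws} (here refl) =
    trans (mark-fixed ws (trans (cong (touch b) eq) (trans (touch-idem b (lookup κ x)) (sym eq)))) eq
    where eq = lookup∘update x κ (touch b (lookup κ x))
  mark-∈ {b} {κ} {x} {w ∷ _} (there x∈) with x ≟ᶠ w
  ... | yes refl = trans (mark-∈ x∈) (trans (cong (touch b) (lookup∘update x κ _)) (touch-idem b (lookup κ x)))
  ... | no x≢w   = trans (mark-∈ x∈) (cong (touch b) (lookup∘update′ x≢w κ _))

  stampAll-∉ : ∀ {b κ x} ws → x ∉ ws → lookup (stampAll b κ ws) x ≡ lookup κ x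
  stampAll-∉         []       _   = refl
  stampAll-∉ {κ = κ} (w ∷ ws) x∉ =
    trans (stampAll-∉ ws (x∉ ∘ there)) (lookup∘update′ (λ { refl → x∉ (here refl) }) κ _)

  stampAll-At : ∀ {b κ x ws p} → Unique ws → At ws p x → lookup (stampAll b κ ws) x ≡ stamp (b + p)
  stampAll-At {b} {κ} {x} {_ ∷ ws} (x∉ws ∷ _) here =
    trans (stampAll-∉ ws (λ x∈ws → All.lookup x∉ws x∈ws refl))
          (trans (lookup∘update x κ _) (cong stamp (sym (+-identityʳ b))))
  stampAll-At {b} {p = suc p} (_ ∷ !ws) (there pos) =
    trans (stampAll-At !ws pos) (cong stamp (sym (+-suc b p)))

  -- The machine filters with keys that change during the scan. `touch` neither creates nor removes
  -- `numbered`, so the outcome is the filter by the keys at the start.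
  active-touch : ∀ b κ w ws → active (κ [ w ]≔ touch b (lookup κ w)) ws ≡ active κ ws
  active-touch b κ w = filter-≐ _ _ ((λ live eq → live (to _ eq)) , λ live eq → live (from _ eq))
    where
    κ′ : Keys
    κ′ = κ [ w ]≔ touch b (lookup κ w)

    to : ∀ x → lookup κ x ≡ numbered → lookup κ′ x ≡ numbered
    to x eq with x ≟ᶠ w
    ... | yes refl = trans (lookup∘update w κ _) (cong (touch b) eq)
    ... | no x≢w   = trans (lookup∘update′ x≢w κ _) eq

    from : ∀ x → lookup κ′ x ≡ numbered → lookup κ x ≡ numbered
    from x eq with x ≟ᶠ w
    ... | yes refl = touch-numbered (trans (sym (lookup∘update w κ _)) eq)
    ... | no x≢w   = trans (sym (lookup∘update′ x≢w κ _)) eq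

-- The invariant of the queue, and why runs of the model are runs of LexDOWN.

module Correctness {n} (G : Graph n) (A : AdjacencyLists G) where
  open Graph G
  open AdjacencyLists A
  open LexDOWN G hiding (_∉_)

  nbr⇒adjacent : ∀ {v w} → w ∈ nbrs v → Adjacent G v w
  nbr⇒adjacent = Equivalence.to (nbrs-∈ _ _)

  adjacent⇒nbr : ∀ {v w} → Adjacent G v w → w ∈ nbrs v
  adjacent⇒nbr = Equivalence.from (nbrs-∈ _ _)

  relabel-moved : ∀ {i v} {σ : Vec (Fin n) i} {ℓ} w → Adjacent G v w → w ∉ᵛ σ →
                  relabel i v σ ℓ w ≡ [ n ∸ i ] ∷ ℓ w
  relabel-moved {v = v} {σ} w v~w w∉σ
    rewrite dec-true (adjacent? G v w) v~w | dec-false (w ∈? σ) w∉σ = refl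

  relabel-kept : ∀ {i v} {σ : Vec (Fin n) i} {ℓ} w → ¬ (Adjacent G v w × w ∉ᵛ σ) →
                 relabel i v σ ℓ w ≡ ℓ w
  relabel-kept {v = v} {σ} w ¬moved
    rewrite dec-false (adjacent? G v w ×-dec ¬? (w ∈? σ)) ¬moved = refl

  -- `h` counts the entries already taken from the queue, so those in `Q` have the indices h, h + 1,
  -- and so on, and h + |Q| is both the next free index and the number of entries ever made. `above`
  -- puts the next letter, n - (i + 1), below all first letters in use. `order` has the negated form
  -- that `Run` demands of a choice. `queued` keeps the latest entry of each labelled unnumbered
  -- vertex in the queue. `explored` and `source-known` serve to show in `complete` that no vertex
  -- is missed.
  record Invariant {i} (κ : Keys) (Q : List (Fin n)) (h : ℕ) (σ : Vec (Fin n) i)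
                   (ℓ : Labelling) : Set where
    field
      run      : Run i ℓ σ
      ∈⇒num    : ∀ {w} → w ∈ᵛ σ → lookup κ w ≡ numbered
      num⇒∈    : ∀ {w} → lookup κ w ≡ numbered → w ∈ᵛ σ
      empty    : ∀ {w} → lookup κ w ≡ unlabelled → ℓ w ≡ []
      above    : ∀ {w t} → lookup κ w ≡ stamp t → Above (n ∸ i) (ℓ w)
      order    : ∀ {w w′ t t′} → lookup κ w ≡ stamp t → lookup κ w′ ≡ stamp t′ →
                 t ≤ t′ → ¬ ℓ w ≺ ℓ w′
      queued   : ∀ {w t} → lookup κ w ≡ stamp t → ∃[ j ] (t ≡ h + j × At Q j w)
      known    : ∀ {w} → w ∈ Q → lookup κ w ≢ unlabelled
      explored : ∀ {u w} → lookup κ u ≡ numbered → Adjacent G u w → lookup κ w ≢ unlabelled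
      source-known : lookup κ source ≢ unlabelled
      count    : i + remaining (λ _ → 1) κ ≡ n
      room     : h + length Q + remaining (degree G A) κ ≤ suc (2 * #edges)

  initialKeys : Keys
  initialKeys = Vec.replicate n unlabelled [ source ]≔ stamp 0

  module _ {i κ v Q h ℓ} {σ : Vec (Fin n) i} (I : Invariant κ (v ∷ Q) h σ ℓ) where
    open Invariant I

    -- Only `queued` is at stake: a vertex whose latest entry is the discarded one would be `v`,
    -- with stamp `h`.
    skip-preserves : lookup κ v ≢ stamp h → Invariant κ Q (suc h) σ ℓ
    skip-preserves κv≢h = record
      { Invariant I
      ; queued = queued′
      ; known  = known ∘ there
      ; room   = ≤-trans (≤-reflexive (cong (_+ remaining (degree G A) κ) (sym (+-suc h (length Q))))) room
      }
      where
      queued′ : ∀ {w t} → lookup κ w ≡ stamp t → ∃[ j ] (t ≡ suc h + j × At Q j w)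
      queued′ eq with queued eq
      ... | _     , refl , here     = contradiction (trans eq (cong stamp (+-identityʳ h))) κv≢h
      ... | suc j , refl , there pos = j , +-suc h j , pos

    module Visit (κv : lookup κ v ≡ stamp h) where

      b : ℕ
      b = suc h + length Q

      κ₁ κ₂ : Keys
      κ₁ = κ [ v ]≔ numbered
      κ₂ = mark b κ₁ (nbrs v)

      remaining-v : ∀ κ′ f → lookup κ′ v ≡ numbered →
                    (∀ {w} → w ≢ v → weight (lookup κ′ w) ≗ weight (lookup κ w)) →
                    remaining f κ ≡ f v + remaining f κ′
      remaining-v κ′ f κ′v same = trans
        (sum-zeroed v (cong (λ k → weight k (f v)) κ′v) (λ w w≢v → same w≢v (f w)))
        (cong (λ k → weight k (f v) + remaining f κ′) κv)

      remaining-chosen : ∀ f → remaining f κ ≡ f v + remaining f κ₁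
      remaining-chosen f = remaining-v κ₁ f (lookup∘update v κ numbered)
        (λ w≢v x → cong (λ k → weight k x) (lookup∘update′ w≢v κ numbered))

      -- `v` itself is still counted by `remaining`. Hence the truncated n ∸ suc i is strictly below
      -- n ∸ i, and the output array has a free cell.
      unfinished : i < n
      unfinished = begin
        suc i                             ≤⟨ s≤s (m≤m+n i _) ⟩
        suc (i + remaining (λ _ → 1) κ₁)  ≡⟨ +-suc i _ ⟨
        i + suc (remaining (λ _ → 1) κ₁)  ≡⟨ cong (λ r → i + r) (remaining-chosen (λ _ → 1)) ⟨
        i + remaining (λ _ → 1) κ         ≡⟨ count ⟩
        n                                 ∎
        where open ≤-Reasoning

      -- Distinct vertices tie in the sort only if both had the empty label, so any resolution of
      -- ties gives a legal run.
      module _ {ws} (ws↭ : ws ↭ active κ₁ (nbrs v)) (sorted : AllPairs (Earlier κ₂) ws) where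

        κ₃ : Keys
        κ₃ = stampAll b κ₂ ws

        private
          ws-unique : Unique ws
          ws-unique = Permutation.Unique-resp-↭ (setoid _)
            (↭⇒↭ₛ (↭-sym ws↭))
            (Unique.filter⁺ _ (nbrs-≢ v))

          κ₁-v : lookup κ₁ v ≡ numbered
          κ₁-v = lookup∘update v κ numbered

          κ₁-≢ : ∀ {w} → w ≢ v → lookup κ₁ w ≡ lookup κ w
          κ₁-≢ w≢v = lookup∘update′ w≢v κ numbered

          -- Ties the keys to the labels: a `moved` vertex gets a new entry and the new letter; a
          -- `kept` neighbour of `v` is already numbered, so `relabel` passes it over too. Most
          -- fields of the invariant are settled by these cases.
          data Fate (w : Fin n) : Set where
            chosen : w ≡ v → lookup κ₃ w ≡ numbered → Fate w
            moved  : ∀ {p} → At ws p w → lookup κ₃ w ≡ stamp (b + p) →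
                     Adjacent G v w → w ≢ v → lookup κ w ≢ numbered →
                     lookup κ₂ w ≡ touch b (lookup κ w) → Fate w
            kept   : w ≢ v → lookup κ₃ w ≡ lookup κ w →
                     (Adjacent G v w → lookup κ w ≡ numbered) → Fate w

          ∈ws⁻ : ∀ {w} → w ∈ ws → w ∈ nbrs v × lookup κ₁ w ≢ numbered
          ∈ws⁻ w∈ = ∈-filter⁻ (λ w → ¬? (numbered? (lookup κ₁ w))) (∈-resp-↭ ws↭ w∈)

          ∈ws⁺ : ∀ {w} → w ∈ nbrs v → lookup κ₁ w ≢ numbered → w ∈ ws
          ∈ws⁺ w∈ live = ∈-resp-↭ (↭-sym ws↭) (∈-filter⁺ (λ w → ¬? (numbered? (lookup κ₁ w))) w∈ live)

          open DecMembership (_≟ᶠ_ {n}) using () renaming (_∈?_ to _∈ˡ?_)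

          κ₃-numbered : ∀ {w} → lookup κ₁ w ≡ numbered → lookup κ₃ w ≡ numbered
          κ₃-numbered eq =
            trans (stampAll-∉ ws (λ w∈ → proj₂ (∈ws⁻ w∈) eq))
                  (trans (mark-fixed (nbrs v) (trans (cong (touch b) eq) (sym eq))) eq)

          fate : ∀ w → Fate w
          fate w with w ≟ᶠ v
          ... | yes refl = chosen refl (κ₃-numbered κ₁-v)
          ... | no w≢v with w ∈ˡ? nbrs v
          ...   | no w∉ = kept w≢v
                    (trans (stampAll-∉ ws (w∉ ∘ proj₁ ∘ ∈ws⁻)) (trans (mark-∉ (nbrs v) w∉) (κ₁-≢ w≢v)))
                    (λ v~w → contradiction (adjacent⇒nbr v~w) w∉)
          ...   | yes w∈ with numbered? (lookup κ₁ w)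
          ...     | yes eq = kept w≢v (trans (κ₃-numbered eq) (sym κw)) (λ _ → κw)
                      where κw = trans (sym (κ₁-≢ w≢v)) eq
          ...     | no live with ∈⇒At (∈ws⁺ w∈ live)
          ...       | p , pos = moved pos (stampAll-At ws-unique pos) (nbr⇒adjacent w∈) w≢v
                        (live ∘ trans (κ₁-≢ w≢v))
                        (trans (mark-∈ w∈) (cong (touch b) (κ₁-≢ w≢v)))

          v∉σ : v ∉ᵛ σ
          v∉σ v∈σ with trans (sym κv) (∈⇒num v∈σ)
          ... | ()

          ℓ′ : Labelling
          ℓ′ = relabel (suc i) v (σ ∷ʳ v) ℓ

          live⇒∉ : ∀ {w} → w ≢ v → lookup κ w ≢ numbered → w ∉ᵛ σ ∷ʳ v
          live⇒∉ w≢v live w∈ with ∈-∷ʳ⁻ {xs = σ} w∈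
          ... | inj₁ w∈σ = live (∈⇒num w∈σ)
          ... | inj₂ w≡v = w≢v w≡v

          ℓ′-moved : ∀ {w} → Adjacent G v w → w ≢ v → lookup κ w ≢ numbered →
                     ℓ′ w ≡ [ n ∸ suc i ] ∷ ℓ w
          ℓ′-moved {w} v~w w≢v live = relabel-moved {σ = σ ∷ʳ v} {ℓ} w v~w (live⇒∉ w≢v live)

          ℓ′-kept : ∀ {w} → (Adjacent G v w → lookup κ w ≡ numbered) → ℓ′ w ≡ ℓ w
          ℓ′-kept {w} f = relabel-kept {σ = σ ∷ʳ v} {ℓ} w λ (v~w , w∉) → w∉ (∈-∷ʳ⁺ˡ (num⇒∈ (f v~w)))

          stamp<b : ∀ {w t} → lookup κ w ≡ stamp t → t < b
          stamp<b eq with queued eq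
          ... | j , refl , pos = ≤-trans (+-monoʳ-< h (At-< pos)) (≤-reflexive (+-suc h (length Q)))

          κ₃-live : ∀ {w} → w ≢ v → weight (lookup κ₃ w) ≗ weight (lookup κ w)
          κ₃-live {w} w≢v x with fate w
          ... | chosen w≡v _           = contradiction w≡v w≢v
          ... | moved _ eq _ _ live _ rewrite eq = sym (weight-live x live)
          ... | kept _ eq _ rewrite eq = refl

          κ₃-v : lookup κ₃ v ≡ numbered
          κ₃-v = κ₃-numbered κ₁-v

        remaining-visit : ∀ f → remaining f κ ≡ f v + remaining f κ₃
        remaining-visit f = remaining-v κ₃ f κ₃-v κ₃-live

        length-ws≤ : length ws ≤ degree G A v
        length-ws≤ = ≤-trans (≤-reflexive (↭-length ws↭)) (length-filter _ (nbrs v))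

        private
          n∸-< : n ∸ suc i < n ∸ i
          n∸-< = ∸-monoʳ-< (n<1+n i) unfinished

          -- Extends `order` to provisional keys: no label is below an empty one, and a vertex with
          -- provisional key `b` never precedes one with an old stamp, as old stamps are below `b`.
          touched-order : ∀ {w w′ t t′} → touch b (lookup κ w) ≡ stamp t →
                          touch b (lookup κ w′) ≡ stamp t′ → t ≤ t′ → ¬ ℓ w ≺ ℓ w′
          touched-order {w} {w′} eq eq′ t≤t′ ℓw≺ with lookup κ w in κw | lookup κ w′ in κw′
          ... | _          | unlabelled = xs≮[] (subst (ℓ w ≺_) (empty κw′) ℓw≺)
          touched-order refl refl b≤t′ ℓw≺ | unlabelled | stamp _ = <⇒≱ (stamp<b κw′) b≤t′
          touched-order refl refl t≤t′ ℓw≺ | stamp _    | stamp _ = order κw κw′ t≤t′ ℓw≺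

          mono : ∀ {w} → lookup κ w ≢ unlabelled → lookup κ₃ w ≢ unlabelled
          mono {w} known eq with fate w
          ... | chosen _ eq′ with () ← trans (sym eq) eq′
          ... | moved _ eq′ _ _ _ _ with () ← trans (sym eq) eq′
          ... | kept _ eq′ _ = known (trans (sym eq′) eq)

          explored-v : ∀ {w} → Adjacent G v w → lookup κ₃ w ≢ unlabelled
          explored-v {w} v~w eq with fate w
          ... | chosen _ eq′ with () ← trans (sym eq) eq′
          ... | moved _ eq′ _ _ _ _ with () ← trans (sym eq) eq′
          ... | kept _ eq′ f with () ← trans (sym eq) (trans eq′ (f v~w))

        visit-preserves : Invariant κ₃ (Q ++ ws) (suc h) (σ ∷ʳ v) ℓ′
        visit-preserves = record
          { run      = number run v v∉σ maximal
          ; ∈⇒num    = λ {w} → ∈⇒num′ w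
          ; num⇒∈    = λ {w} → num⇒∈′ w
          ; empty    = λ {w} → empty′ w
          ; above    = λ {w} → above′ w
          ; order    = λ {w} {w′} → order′ w w′
          ; queued   = λ {w} → queued′ w
          ; known    = known′
          ; explored = λ {u} → explored′ u
          ; source-known = mono source-known
          ; count    = trans (sym (+-suc i _)) (trans (cong (λ r → i + r) (sym (remaining-visit (λ _ → 1)))) count)
          ; room     = room′
          }
          where
          -- The stamp of any other candidate is `h + j`, at least that of `v`.
          maximal : ∀ w → w ∉ᵛ σ → ¬ ℓ v ≺ ℓ w
          maximal w w∉σ ℓv≺ with lookup κ w in κw
          ... | unlabelled = xs≮[] (subst (ℓ v ≺_) (empty κw) ℓv≺)
          ... | numbered   = w∉σ (num⇒∈ κw)
          ... | stamp t with queued κw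
          ...   | j , refl , _ = order κv κw (m≤m+n h j) ℓv≺

          ∈⇒num′ : ∀ w → w ∈ᵛ (σ ∷ʳ v) → lookup κ₃ w ≡ numbered
          ∈⇒num′ w w∈ with fate w
          ... | chosen _ eq             = eq
          ... | moved _ _ _ w≢v live _ = contradiction w∈ (live⇒∉ w≢v live)
          ... | kept w≢v eq _ with ∈-∷ʳ⁻ {xs = σ} w∈
          ...   | inj₁ w∈σ = trans eq (∈⇒num w∈σ)
          ...   | inj₂ w≡v = contradiction w≡v w≢v

          num⇒∈′ : ∀ w → lookup κ₃ w ≡ numbered → w ∈ᵛ (σ ∷ʳ v)
          num⇒∈′ w eq with fate w
          ... | chosen refl _ = ∈-∷ʳ⁺ʳ σ
          ... | moved _ eq′ _ _ _ _ with () ← trans (sym eq) eq′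
          ... | kept _ eq′ _ = ∈-∷ʳ⁺ˡ (num⇒∈ (trans (sym eq′) eq))

          empty′ : ∀ w → lookup κ₃ w ≡ unlabelled → ℓ′ w ≡ []
          empty′ w eq with fate w
          ... | chosen _ eq′ with () ← trans (sym eq) eq′
          ... | moved _ eq′ _ _ _ _ with () ← trans (sym eq) eq′
          ... | kept _ eq′ f = trans (ℓ′-kept f) (empty (trans (sym eq′) eq))

          above′ : ∀ w {t} → lookup κ₃ w ≡ stamp t → Above (n ∸ suc i) (ℓ′ w)
          above′ w eq with fate w
          ... | chosen _ eq′ with () ← trans (sym eq) eq′
          ... | moved _ _ v~w w≢v live _ =
                  _ , _ , ℓ′-moved v~w w≢v live , λ { refl → ≤-refl }
          ... | kept _ eq′ f with above (trans (sym eq′) eq)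
          ...   | a , ys , ℓw , b≤ = a , ys , trans (ℓ′-kept f) ℓw , λ a≡ → ≤-trans (<⇒≤ n∸-<) (b≤ a≡)

          order′ : ∀ w w′ {t t′} → lookup κ₃ w ≡ stamp t → lookup κ₃ w′ ≡ stamp t′ →
                   t ≤ t′ → ¬ ℓ′ w ≺ ℓ′ w′
          order′ w w′ eq eq′ t≤t′ with fate w | fate w′
          ... | chosen _ num | _ with () ← trans (sym eq) num
          order′ w w′ eq eq′ t≤t′ | moved _ _ _ _ _ _ | chosen _ num with () ← trans (sym eq′) num
          order′ w w′ eq eq′ t≤t′ | kept _ _ _ | chosen _ num with () ← trans (sym eq′) num
          order′ w w′ eq eq′ t≤t′ | kept _ κw f | kept _ κw′ f′
            rewrite ℓ′-kept f | ℓ′-kept f′ = order (trans (sym κw) eq) (trans (sym κw′) eq′) t≤t′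
          -- The new letter at the front of the label of `w′` is below the first letter of every
          -- kept label.
          order′ w w′ eq eq′ t≤t′ | kept _ κw f | moved _ _ v~w′ w′≢v live′ _
            rewrite ℓ′-kept f | ℓ′-moved v~w′ w′≢v live′ = Above-⊀ n∸-< (above (trans (sym κw) eq))
          -- Impossible: kept stamps are below `b`, new ones are not.
          order′ w w′ eq eq′ t≤t′ | moved _ κw _ _ _ _ | kept _ κw′ _ =
            contradiction t≤t′ (<⇒≱ (<-≤-trans (stamp<b (trans (sym κw′) eq′))
              (≤-trans (m≤m+n b _) (≤-reflexive (stamp-injective (trans (sym κw) eq))))))
          -- Both labels got the same letter in front, so the old labels decide; the sort has
          -- arranged them by their touched keys.
          order′ w w′ eq eq′ t≤t′
            | moved {p} pos κw v~w w≢v live κ₂w | moved {p′} pos′ κw′ v~w′ w′≢v live′ κ₂w′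
            rewrite ℓ′-moved v~w w≢v live | ℓ′-moved v~w′ w′≢v live′ = ∷-⊀ ℓ-order
            where
            ℓ-order : ¬ ℓ w ≺ ℓ w′
            ℓ-order with <-cmp p p′
            ... | tri≈ _ refl _ rewrite At-functional pos pos′ = ≺-irrefl
            ... | tri> _ _ p′<p = contradiction
                    (subst₂ _≤_ (stamp-injective (trans (sym eq) κw)) (stamp-injective (trans (sym eq′) κw′)) t≤t′)
                    (<⇒≱ (+-monoʳ-< b p′<p))
            ... | tri< p<p′ _ _ with touch-live b live | touch-live b live′
            ...   | t , τw | t′ , τw′ = touched-order τw τw′
                      (AllPairs-At sorted p<p′ pos pos′ (trans κ₂w τw) (trans κ₂w′ τw′))

          queued′ : ∀ w {t} → lookup κ₃ w ≡ stamp t → ∃[ j ] (t ≡ suc h + j × At (Q ++ ws) j w)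
          queued′ w eq with fate w
          ... | chosen _ num with () ← trans (sym eq) num
          ... | moved {p} pos κw _ _ _ _ =
                  length Q + p ,
                  trans (stamp-injective (trans (sym eq) κw)) (+-assoc (suc h) (length Q) p) ,
                  At-++⁺ʳ Q pos
          ... | kept w≢v κw _ with queued (trans (sym κw) eq)
          ...   | _     , _    , here     = contradiction refl w≢v
          ...   | suc j , refl , there pos = j , +-suc h j , At-++⁺ˡ pos

          known′ : ∀ {w} → w ∈ Q ++ ws → lookup κ₃ w ≢ unlabelled
          known′ w∈ with ∈-++⁻ Q w∈
          ... | inj₁ w∈Q  = mono (known (there w∈Q))
          ... | inj₂ w∈ws = explored-v (nbr⇒adjacent (proj₁ (∈ws⁻ w∈ws)))

          explored′ : ∀ u {w} → lookup κ₃ u ≡ numbered → Adjacent G u w → lookup κ₃ w ≢ unlabelled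
          explored′ u eq u~w with fate u
          ... | chosen refl _ = explored-v u~w
          ... | moved _ κu _ _ _ _ with () ← trans (sym eq) κu
          ... | kept _ κu _ = mono (explored (trans (sym κu) eq) u~w)

          room′ : suc h + length (Q ++ ws) + remaining (degree G A) κ₃ ≤ suc (2 * #edges)
          room′ = begin
            suc h + length (Q ++ ws) + R          ≡⟨ cong (λ l → suc h + l + R) (length-++ Q) ⟩
            -- The new entries are paid for by the degree of `v`, which leaves `remaining`.
            suc h + (length Q + length ws) + R    ≤⟨ +-monoˡ-≤ R (+-monoʳ-≤ (suc h) (+-monoʳ-≤ (length Q) length-ws≤)) ⟩
            suc h + (length Q + degree G A v) + R ≡⟨ cong (_+ R) (+-assoc (suc h) _ _) ⟨
            suc h + length Q + degree G A v + R   ≡⟨ +-assoc (suc h + length Q) _ R ⟩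
            suc h + length Q + (degree G A v + R) ≡⟨ cong₂ _+_ (+-suc h (length Q)) (remaining-visit (degree G A)) ⟨
            h + suc (length Q) + remaining (degree G A) κ ≤⟨ room ⟩
            suc (2 * #edges) ∎
            where
            open ≤-Reasoning
            R = remaining (degree G A) κ₃

  private
    κ₀ : Keys
    κ₀ = initialKeys

    κ₀-source : lookup κ₀ source ≡ stamp 0
    κ₀-source = lookup∘update source (Vec.replicate n unlabelled) (stamp 0)

    κ₀-other : ∀ {w} → w ≢ source → lookup κ₀ w ≡ unlabelled
    κ₀-other {w} w≢s = trans (lookup∘update′ w≢s (Vec.replicate n unlabelled) (stamp 0))
                             (lookup-replicate w unlabelled)

    κ₀-live : ∀ w → lookup κ₀ w ≢ numbered
    κ₀-live w eq with w ≟ᶠ source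
    ... | yes refl with () ← trans (sym eq) κ₀-source
    ... | no w≢s with () ← trans (sym eq) (κ₀-other w≢s)

    κ₀-stamp : ∀ {w t} → lookup κ₀ w ≡ stamp t → w ≡ source × t ≡ 0
    κ₀-stamp {w} eq with w ≟ᶠ source
    ... | yes refl = refl , stamp-injective (trans (sym eq) κ₀-source)
    ... | no w≢s with () ← trans (sym eq) (κ₀-other w≢s)

  remaining-initial : ∀ f → remaining f κ₀ ≡ sum f
  remaining-initial f = sum-cong-≗ λ w → weight-live (f w) (κ₀-live w)

  private
    sum-1 : ∀ k → sum {k} (λ _ → 1) ≡ k
    sum-1 zero    = refl
    sum-1 (suc k) = cong suc (sum-1 k)

  initial-invariant : Invariant κ₀ (source ∷ []) 0 Vec.[] initial
  initial-invariant = record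
    { run      = start
    ; ∈⇒num    = λ ()
    ; num⇒∈    = λ {w} eq → contradiction eq (κ₀-live w)
    ; empty    = λ {w} → empty₀ w
    ; above    = λ eq → above₀ (proj₁ (κ₀-stamp eq))
    ; order    = order₀
    ; queued   = λ eq → queued₀ (κ₀-stamp eq)
    ; known    = λ { (here refl) eq → known₀ eq }
    ; explored = λ {u} eq _ → contradiction eq (κ₀-live u)
    ; source-known = known₀
    ; count    = trans (remaining-initial _) (sum-1 n)
    -- The 1 in 1 + 2m is the entry of the source, which is charged to no degree.
    ; room     = s≤s (≤-trans (≤-reflexive (remaining-initial _)) (handshake G A))
    }
    where
    known₀ : lookup κ₀ source ≢ unlabelled
    known₀ eq with () ← trans (sym eq) κ₀-source

    empty₀ : ∀ w → lookup κ₀ w ≡ unlabelled → initial w ≡ []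
    empty₀ w eq with w ≟ᶠ source
    ... | yes refl with () ← trans (sym eq) κ₀-source
    ... | no _     = refl

    above₀ : ∀ {w} → w ≡ source → Above n (initial w)
    above₀ refl rewrite dec-true (source ≟ᶠ source) refl = ⊤⁺ , [] , refl , λ ()

    order₀ : ∀ {w w′ t t′} → lookup κ₀ w ≡ stamp t → lookup κ₀ w′ ≡ stamp t′ →
             t ≤ t′ → ¬ initial w ≺ initial w′
    order₀ eq eq′ _ with κ₀-stamp eq | κ₀-stamp eq′
    ... | refl , _ | refl , _ = ≺-irrefl

    queued₀ : ∀ {w t} → w ≡ source × t ≡ 0 → ∃[ j ] (t ≡ j × At (source ∷ []) j w)
    queued₀ (refl , refl) = 0 , refl , here

  -- With an empty queue no key is a stamp, so every known vertex is numbered. By `explored` this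
  -- spreads from the source along paths.
  complete : Connected G → ∀ {i κ h ℓ} {σ : Vec (Fin n) i} → Invariant κ [] h σ ℓ → i ≡ n
  complete connected {i} {κ} I = begin
    i                             ≡⟨ +-identityʳ i ⟨
    i + 0                         ≡⟨ cong (λ r → i + r) (sum-replicate-zero n) ⟨
    i + sum {n} (λ _ → 0)
      ≡⟨ cong (λ r → i + r) (sum-cong-≗ λ w → cong (λ k → weight k 1) (sym (all-numbered w))) ⟩
    i + remaining (λ _ → 1) κ     ≡⟨ count ⟩
    n                             ∎
    where
    open ≡-Reasoning
    open Invariant I

    known⇒numbered : ∀ {w} → lookup κ w ≢ unlabelled → lookup κ w ≡ numbered
    known⇒numbered {w} known with lookup κ w in κw
    ... | unlabelled = contradiction refl known
    ... | numbered   = refl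
    ... | stamp _ with queued κw
    ...   | _ , _ , ()

    spread : ∀ {u w} → Star (Adjacent G) u w → lookup κ u ≡ numbered → lookup κ w ≡ numbered
    spread ε            eq = eq
    spread (u~x ◅ rest) eq = spread rest (known⇒numbered (explored eq u~x))

    all-numbered : ∀ w → lookup κ w ≡ numbered
    all-numbered w with source ≟ᶠ w
    ... | yes refl = known⇒numbered source-known
    ... | no s≢w   = spread (connected source w s≢w) (known⇒numbered source-known)

-- The program.

nonempty : ℕ → Test
nonempty q = not (isNil (first (var q)))

pop : ℕ → ℕ → Cmd
pop x q = x := value (first (var q)) ⨟ remove (first (var q))

-- Registers: 3 holds the array of keys, 4 the output, 5 the queue, 6 an
-- auxiliary list, 7 the index of the last entry removed from the queue, 8 that
-- of the last entry added to it, and 9 the number of numbered vertices.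
-- The key of a vertex is nil before it has a label, then the index of its
-- current entry in the queue, and −1 once it is numbered. Older entries of the
-- vertex stay in the queue and are skipped.

enqueueBatch : Cmd
enqueueBatch =
  while (nonempty 6) (
    pop 12 6 ⨟
    8 := inc (var 8) ⨟
    write (var 3) (var 12) (var 8) ⨟
    pushBack (var 5) (var 12))

-- The first conditional replaces nil by an integer, as comparing or sorting by nil would be a
-- fault; the second leaves out the key -1. Register 8 stays unchanged, so all newly labelled
-- neighbours share one provisional key.
collect : Cmd
collect =
  while (not (isNil (var 11))) (
    12 := value (var 11) ⨟
    cond (isNil (var 3 at var 12)) (write (var 3) (var 12) (inc (var 8))) skip ⨟
    cond (lit (+ 0) ≤ᵗ var 3 at var 12) (pushBack (var 6) (var 12)) skip ⨟
    11 := next (var 11))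

visit : Cmd
visit =
  write (var 3) (var 10) (lit -[1+ 0 ]) ⨟
  write (var 4) (var 9) (var 10) ⨟
  9 := inc (var 9) ⨟
  11 := first (var 0 at var 10) ⨟
  collect ⨟
  sort (var 6) 12 (var 3 at var 12) ⨟
  enqueueBatch

search : Cmd
search =
  while (nonempty 5) (
    pop 10 5 ⨟
    7 := inc (var 7) ⨟
    cond (var 3 at var 10 ≡ᵗ var 7) visit skip)

program : Cmd
program =
  newArray 3 (var 1) nil ⨟
  newArray 4 (var 1) nil ⨟
  newList 5 ⨟
  newList 6 ⨟
  7 := lit -[1+ 0 ] ⨟
  8 := lit (+ 0) ⨟
  9 := lit (+ 0) ⨟
  write (var 3) (var 2) (lit (+ 0)) ⨟
  pushBack (var 5) (var 2) ⨟
  search ⨟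
  0 := var 4

-- Representation of the model in machine states.

-- Registers hold the last index, not the next: `room` lets the next one be 2m + 1, which may exceed
-- `B`.
before : ℕ → ℤ
before zero    = -[1+ 0 ]
before (suc k) = + k

suc-before : ∀ k → ℤ.suc (before k) ≡ + k
suc-before zero    = refl
suc-before (suc k) = refl

encode : Key → Val
encode unlabelled = nil
encode numbered   = int -[1+ 0 ]
encode (stamp t)  = int (+ t)

module _ {A : Set} (f : ℕ → A) (x : ℕ) {a : A} where

  update-≡ : (f [ x ↦ a ]) x ≡ a
  update-≡ with x ≡ᵇ x | ≡⇒≡ᵇ x x refl
  ... | true | _ = refl

  update-≢ : ∀ {y} → y ≢ x → (f [ x ↦ a ]) y ≡ f y
  update-≢ {y} y≢x with y ≡ᵇ x | ≡ᵇ⇒≡ y x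
  ... | true  | eq = contradiction (eq _) y≢x
  ... | false | _  = refl

uncons : ∀ {v vs} {ns : List Node} → map proj₂ ns ≡ v ∷ vs →
         ∃[ k ] ∃[ ns′ ] (ns ≡ (k , v) ∷ ns′ × map proj₂ ns′ ≡ vs)
uncons {ns = (k , _) ∷ ns′} refl = k , ns′ , refl , refl

uncons-[] : ∀ {ns : List Node} → map proj₂ ns ≡ [] → ns ≡ []
uncons-[] {[]} _ = refl

rank : Key → ℤ
rank (stamp t) = + t
rank _         = + 0

module _ {n : ℕ} where

  -- The rule for `sort` asks for a total key function. The default 0 is never met in a sorted
  -- batch, where all values are vertices with stamps.
  keyOf : Vec Key n → Val → ℤ
  keyOf κ (int (+ j)) with j <? n
  ... | yes j<n = rank (lookup κ (fromℕ< j<n))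
  ... | no _    = + 0
  keyOf κ _ = + 0

  keyOf-vertex : ∀ κ w → keyOf κ (vertex w) ≡ rank (lookup κ w)
  keyOf-vertex κ w with toℕ w <? n
  ... | yes j<n = cong (rank ∘ lookup κ) (fromℕ<-toℕ w j<n)
  ... | no j≮n  = contradiction (toℕ<n w) j≮n

  sortBy-vertices : ∀ (κ : Vec Key n) {ns ws} → map proj₂ ns ≡ map vertex ws →
    ∃[ ws′ ] (map proj₂ (sortBy (keyOf κ) ns) ≡ map vertex ws′ × ws′ ↭ ws × AllPairs (Earlier κ) ws′)
  sortBy-vertices κ {ns} {ws} eq
    with ↭-map-inv vertex (subst (_↭ map proj₂ (sortBy (keyOf κ) ns)) eq
           (↭-sym (map⁺ proj₂ (Sort.sort-↭ (On.decTotalOrder ℤ.≤-decTotalOrder (keyOf κ ∘ proj₂)) ns))))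
  ... | ws′ , eq′ , ws↭ws′ = ws′ , eq′ , ↭-sym ws↭ws′ ,
      AllPairs.map earlier (AllPairs.map⁻ (subst (AllPairs _) eq′ (AllPairs.map⁺ sorted)))
    where
    O = On.decTotalOrder ℤ.≤-decTotalOrder (keyOf κ ∘ proj₂)

    sorted : AllPairs (λ x y → keyOf κ (proj₂ x) ℤ.≤ keyOf κ (proj₂ y)) (sortBy (keyOf κ) ns)
    sorted = Sorted.Sorted⇒AllPairs (DecTotalOrder.totalOrder O) (Sort.sort-↗ O ns)

    earlier : ∀ {x y} → keyOf κ (vertex x) ℤ.≤ keyOf κ (vertex y) → Earlier κ x y
    earlier {x} {y} x≤y κx κy = ℤ.drop‿+≤+ (subst₂ ℤ._≤_
      (trans (keyOf-vertex κ x) (cong rank κx)) (trans (keyOf-vertex κ y) (cong rank κy)) x≤y)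

  -- Positions are compared as numbers, since the types do not relate `i` to `n`. Cells from `i` on
  -- are left open.
  Prefix : ∀ {i} → Vec (Fin n) i → Vec Val n → Set
  Prefix {i} σ out = ∀ (j : Fin i) (k : Fin n) → toℕ j ≡ toℕ k → lookup out k ≡ vertex (lookup σ j)

lookup-∷ʳ : ∀ {A : Set} {i} (xs : Vec A i) x (j : Fin (suc i)) →
            (toℕ j ≡ i × lookup (xs ∷ʳ x) j ≡ x) ⊎
            (∃[ j′ ] (toℕ j ≡ toℕ j′ × lookup (xs ∷ʳ x) j ≡ lookup xs j′))
lookup-∷ʳ Vec.[]       x zero = inj₁ (refl , refl)
lookup-∷ʳ (y Vec.∷ xs) x zero = inj₂ (zero , refl , refl)
lookup-∷ʳ (y Vec.∷ xs) x (suc j) with lookup-∷ʳ xs x j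
... | inj₁ (j≡i , eq)       = inj₁ (cong suc j≡i , eq)
... | inj₂ (j′ , j≡j′ , eq) = inj₂ (suc j′ , cong suc j≡j′ , eq)

Prefix-∷ʳ : ∀ {n i} {σ : Vec (Fin n) i} {out} {k : Fin n} v → toℕ k ≡ i →
            Prefix σ out → Prefix (σ ∷ʳ v) (out [ k ]≔ vertex v)
Prefix-∷ʳ {i = i} {σ} {out} {k} v k≡i prefix j l j≡l with lookup-∷ʳ σ v j
... | inj₁ (j≡i , eq) with toℕ-injective {i = l} {k} (trans (sym j≡l) (trans j≡i (sym k≡i)))
...   | refl = trans (lookup∘update k out (vertex v)) (cong vertex (sym eq))
Prefix-∷ʳ {i = i} {σ} {out} {k} v k≡i prefix j l j≡l | inj₂ (j′ , j≡j′ , eq) =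
  trans (lookup∘update′ l≢k out (vertex v))
        (trans (prefix j′ l (trans (sym j≡j′) j≡l)) (cong vertex (sym eq)))
  where
  l≢k : l ≢ k
  l≢k refl = <⇒≢ (toℕ<n j′) (trans (sym j≡j′) (trans j≡l k≡i))

-- The factor 3 is the size of the key expression `var 3 at var 12`.
sortTime : ℕ → ℕ
sortTime k = 3 * (k * ⌈log₂ k ⌉)

-- Execution and running time of the inner loops and of a visit.

module Machine {n} (G : Graph n) (A : AdjacencyLists G) where
  open Graph G
  open AdjacencyLists A
  open Correctness G A

  B : ℕ
  B = n ⊔ 2 * #edges

  open Execution B

  Runs : State → Cmd → ℕ → (State → Set) → Set
  Runs s c T P = ∃[ t ] ∃[ s′ ] (s ⊢ c ⇓[ t ] s′ × t ≤ T × P s′)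

  seq : ∀ {s c c′ T T′ P R} → Runs s c T P → (∀ {s′} → P s′ → Runs s′ c′ T′ R) →
        Runs s (c ⨟ c′) (T + T′) R
  seq (_ , _ , c⇓ , t≤T , p) f with f p
  ... | _ , _ , c′⇓ , t′≤T′ , r = _ , _ , ⇓⨟ c⇓ c′⇓ , +-mono-≤ t≤T t′≤T′ , r

  infixr 4 _⨟→_
  _⨟→_ : ∀ {s s′ c c′ t T R} → s ⊢ c ⇓[ t ] s′ → Runs s′ c′ T R → Runs s (c ⨟ c′) (t + T) R
  c⇓ ⨟→ (_ , _ , c′⇓ , t≤T , r) = _ , _ , ⇓⨟ c⇓ c′⇓ , +-monoʳ-≤ _ t≤T , r

  done : ∀ {s s′ c t} {R : State → Set} → s ⊢ c ⇓[ t ] s′ → R s′ → Runs s c t R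
  done c⇓ r = _ , _ , c⇓ , ≤-refl , r

  within : ∀ {s c T T′ R} → T ≤ T′ → Runs s c T R → Runs s c T′ R
  within T≤T′ (_ , _ , c⇓ , t≤T , r) = _ , _ , c⇓ , ≤-trans t≤T T≤T′ , r

  post : ∀ {s c T} {R R′ : State → Set} → (∀ {s′} → R s′ → R′ s′) → Runs s c T R → Runs s c T R′
  post f (_ , _ , c⇓ , t≤T , r) = _ , _ , c⇓ , t≤T , f r

  cond-true : ∀ {s b c c′ T R} → s ⊢ b ⇓ᵗ true → Runs s c T R → Runs s (cond b c c′) (suc (sizeᵗ b + T)) R
  cond-true b⇓ (_ , _ , c⇓ , t≤T , r) = _ , _ , ⇓cond-true b⇓ c⇓ , s≤s (+-monoʳ-≤ _ t≤T) , r

  cond-false : ∀ {s b c c′ T R} → s ⊢ b ⇓ᵗ false → Runs s c′ T R → Runs s (cond b c c′) (suc (sizeᵗ b + T)) R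
  cond-false b⇓ (_ , _ , c⇓ , t≤T , r) = _ , _ , ⇓cond-false b⇓ c⇓ , s≤s (+-monoʳ-≤ _ t≤T) , r

  iterate : ∀ {s b c T T′ P R} → s ⊢ b ⇓ᵗ true → Runs s c T P →
            (∀ {s′} → P s′ → Runs s′ (while b c) T′ R) →
            Runs s (while b c) (suc (sizeᵗ b + T + T′)) R
  iterate {b = b} b⇓ (_ , _ , c⇓ , t≤T , p) f with f p
  ... | _ , _ , w⇓ , t′≤T′ , r =
    _ , _ , ⇓while-true b⇓ c⇓ w⇓ , s≤s (+-mono-≤ (+-monoʳ-≤ (sizeᵗ b) t≤T) t′≤T′) , r

  ⇓reg : ∀ {s x v} → reg s x ≡ v → s ⊢ var x ⇓ v
  ⇓reg refl = ⇓var

  ⇓first-∷ : ∀ {s e l k v ns} → s ⊢ e ⇓ list l → lists s l ≡ (k , v) ∷ ns → s ⊢ first e ⇓ node l k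
  ⇓first-∷ {s} {e} {l} e⇓ eq = subst (λ ns → s ⊢ first e ⇓ nodeRef l (List.head ns)) eq (⇓first e⇓)

  ⇓nonempty-true : ∀ {s q l k v ns} → reg s q ≡ list l → lists s l ≡ (k , v) ∷ ns → s ⊢ nonempty q ⇓ᵗ true
  ⇓nonempty-true q≡l eq = ⇓not (⇓isNil (⇓first-∷ (⇓reg q≡l) eq))

  ⇓nonempty-false : ∀ {s q l} → reg s q ≡ list l → lists s l ≡ [] → s ⊢ nonempty q ⇓ᵗ false
  ⇓nonempty-false {s} {q} {l} q≡l eq =
    ⇓not (⇓isNil (subst (λ ns → s ⊢ first (var q) ⇓ nodeRef l (List.head ns)) eq (⇓first (⇓reg q≡l))))

  ⇓pop : ∀ {s x q l k v ns} → reg s q ≡ list l → reg (setReg x v s) q ≡ list l →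
         lists s l ≡ (k , v) ∷ ns → s ⊢ pop x q ⇓[ 7 ] setList l ns (setReg x v s)
  ⇓pop q≡l q≡l′ eq =
    ⇓⨟ (⇓:= (⇓value {ns = []} (⇓first-∷ (⇓reg q≡l) eq) eq))
       (⇓remove {ns = []} (⇓first-∷ (⇓reg q≡l′) eq) eq)

  ⇓inc-before : ∀ {s x k} → reg s x ≡ int (before k) → k ≤ B → s ⊢ inc (var x) ⇓ int (+ k)
  ⇓inc-before {s} {x} {k} eq k≤B = subst (λ z → s ⊢ inc (var x) ⇓ int z) (suc-before k)
    (⇓inc (⇓reg eq) (subst (λ z → ℤ.∣ z ∣ ≤ B) (sym (suc-before k)) k≤B))

  -- The input uses references below n and sets `fresh` to n; the four allocations of `program`
  -- therefore yield n to 3 + n.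
  record Regs (r : ℕ → Val) (h b i : ℕ) : Set where
    field
      r0 : r 0 ≡ arr 0
      r3 : r 3 ≡ arr n
      r4 : r 4 ≡ arr (1 + n)
      r5 : r 5 ≡ list (2 + n)
      r6 : r 6 ≡ list (3 + n)
      r7 : r 7 ≡ int (before h)
      r8 : r 8 ≡ int (before b)
      r9 : r 9 ≡ int (+ i)

  record Arrays (a : ℕ → Σ ℕ (Vec Val)) (κ : Keys) {i} (σ : Vec (Fin n) i) : Set where
    field
      adjacency : a 0 ≡ (n , Vec.tabulate (list ∘ toℕ))
      keys      : a n ≡ (n , Vec.map encode κ)
      out       : Vec Val n
      output    : a (1 + n) ≡ (n , out)
      prefix    : Prefix σ out

  record Lists (l : ℕ → List Node) (Q W : List (Fin n)) : Set where
    field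
      neighbours : ∀ v → map proj₂ (l (toℕ v)) ≡ map vertex (nbrs v)
      queue      : map proj₂ (l (2 + n)) ≡ map vertex Q
      batch      : map proj₂ (l (3 + n)) ≡ map vertex W

  record Represents (s : State) (κ : Keys) {i} (σ : Vec (Fin n) i) (Q W : List (Fin n)) (h b : ℕ) : Set where
    field
      regs   : Regs (reg s) h b i
      arrays : Arrays (arrs s) κ σ
      lsts   : Lists (lists s) Q W
    open Regs regs public
    open Arrays arrays public
    open Lists lsts public

  -- Keeps the key array, at reference n, apart from the adjacency array, at reference 0; it also
  -- makes -1 representable.
  n≢0 : n ≢ 0
  n≢0 refl with () ← source

  -- Against `10 + k` the test `≡ᵇ` computes to false for the registers 0 to 9, so all fields hold
  -- by definition.
  Regs-temporary : ∀ {r h b i v} k → Regs r h b i → Regs (r [ 10 + k ↦ v ]) h b i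
  Regs-temporary k R = record { Regs R }

  Regs-7 : ∀ {r h b i} h′ → Regs r h b i → Regs (r [ 7 ↦ int (before h′) ]) h′ b i
  Regs-7 h′ R = record { Regs R hiding (r7) ; r7 = refl }

  Regs-8 : ∀ {r h b i} b′ → Regs r h b i → Regs (r [ 8 ↦ int (before b′) ]) h b′ i
  Regs-8 b′ R = record { Regs R hiding (r8) ; r8 = refl }

  Regs-9 : ∀ {r h b i} i′ → Regs r h b i → Regs (r [ 9 ↦ int (+ i′) ]) h b i′
  Regs-9 i′ R = record { Regs R hiding (r9) ; r9 = refl }

  Arrays-key : ∀ {a κ i} {σ : Vec (Fin n) i} w k → Arrays a κ σ →
               Arrays (a [ n ↦ (n , Vec.map encode κ [ w ]≔ encode k) ]) (κ [ w ]≔ k) σ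
  Arrays-key {a} {κ} w k R = record
    { adjacency = trans (update-≢ a n (n≢0 ∘ sym)) adjacency
    ; keys      = trans (update-≡ a n) (cong (n ,_) (sym (map-[]≔ encode κ w)))
    ; output    = trans (update-≢ a n 1+n≢n) output
    ; prefix    = prefix
    } where open Arrays R

  Arrays-output : ∀ {a κ i} {σ : Vec (Fin n) i} v {k} (R : Arrays a κ σ) → toℕ k ≡ i →
                  Arrays (a [ 1 + n ↦ (n , Arrays.out R [ k ]≔ vertex v) ]) κ (σ ∷ʳ v)
  Arrays-output {a} {σ = σ} v R k≡i = record
    { adjacency = adjacency
    ; keys      = trans (update-≢ a (1 + n) (1+n≢n ∘ sym)) keys
    ; output    = update-≡ a (1 + n)
    ; prefix    = Prefix-∷ʳ {σ = σ} {out} v k≡i prefix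
    } where open Arrays R

  toℕ≢ : ∀ {k} (v : Fin n) → toℕ v ≢ k + n
  toℕ≢ {k} v = <⇒≢ (<-≤-trans (toℕ<n v) (m≤n+m n k))

  Lists-queue : ∀ {l Q Q′ W ns} → Lists l Q W → map proj₂ ns ≡ map vertex Q′ → Lists (l [ 2 + n ↦ ns ]) Q′ W
  Lists-queue {l} R eq = record
    { neighbours = λ v → trans (cong (map proj₂) (update-≢ l (2 + n) (toℕ≢ {2} v))) (neighbours v)
    ; queue      = trans (cong (map proj₂) (update-≡ l (2 + n))) eq
    ; batch      = trans (cong (map proj₂) (update-≢ l (2 + n) 1+n≢n)) batch
    } where open Lists R

  Lists-batch : ∀ {l Q W W′ ns} → Lists l Q W → map proj₂ ns ≡ map vertex W′ → Lists (l [ 3 + n ↦ ns ]) Q W′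
  Lists-batch {l} R eq = record
    { neighbours = λ v → trans (cong (map proj₂) (update-≢ l (3 + n) (toℕ≢ {3} v))) (neighbours v)
    ; queue      = trans (cong (map proj₂) (update-≢ l (3 + n) (1+n≢n ∘ sym))) queue
    ; batch      = trans (cong (map proj₂) (update-≡ l (3 + n))) eq
    } where open Lists R

  Represents-temporary : ∀ {s κ i Q W h b v} {σ : Vec (Fin n) i} k → Represents s κ σ Q W h b →
                         Represents (setReg (10 + k) v s) κ σ Q W h b
  Represents-temporary k R = record { regs = Regs-temporary k regs ; arrays = arrays ; lsts = lsts }
    where open Represents R

  push-vertex : ∀ {ns : List Node} {k} {ws : List (Fin n)} w → map proj₂ ns ≡ map vertex ws →
                map proj₂ (ns List.∷ʳ (k , vertex w)) ≡ map vertex (ws List.∷ʳ w)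
  push-vertex {ns} {k} {ws} w eq = begin
    map proj₂ (ns List.∷ʳ (k , vertex w)) ≡⟨ map-++ proj₂ ns _ ⟩
    map proj₂ ns List.∷ʳ vertex w         ≡⟨ cong (List._∷ʳ vertex w) eq ⟩
    map vertex ws List.∷ʳ vertex w        ≡⟨ map-++ vertex ws _ ⟨
    map vertex (ws List.∷ʳ w)             ∎
    where open ≡-Reasoning

  ⇓key : ∀ {s x a κ} w → reg s 3 ≡ arr a → arrs s a ≡ (n , Vec.map encode κ) → reg s x ≡ vertex w →
         s ⊢ var 3 at var x ⇓ encode (lookup κ w)
  ⇓key {s} {x} {κ = κ} w 3≡ eq x≡ = subst (s ⊢ var 3 at var x ⇓_) (lookup-map w encode κ)
    (⇓at (⇓reg 3≡) eq (⇓reg x≡))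

  -- A turn costs 5 for the test and 17 for the body, the failing test 5. The next index may end at
  -- `suc B`, register 8 then holding `B`.
  enqueue-runs : ∀ ws {s κ i Q h b} {σ : Vec (Fin n) i} → Represents s κ σ Q ws h b →
                 b + length ws ≤ suc B →
                 Runs s enqueueBatch (22 * length ws + 5)
                   (λ s′ → Represents s′ (stampAll b κ ws) σ (Q ++ ws) [] h (b + length ws))
  enqueue-runs [] {s} {κ} {Q = Q} {h} {b} {σ} R _ =
    done (⇓while-false (⇓nonempty-false r6 (uncons-[] batch)))
         (subst₂ (λ Q b → Represents s κ σ Q [] h b) (sym (++-identityʳ Q)) (sym (+-identityʳ b)) R)
    where open Represents R
  enqueue-runs (w ∷ ws) {κ = κ} {Q = Q} {h} {b} {σ} R room with uncons (Represents.batch R)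
  ... | k , ns , eq , ns≡ws = within (≤-reflexive time) (iterate (⇓nonempty-true r6 eq) body λ R′ →
        post (λ {s′} → subst₂ (λ Q′ b′ → Represents s′ (stampAll (suc b) (κ [ w ]≔ stamp b) ws) σ Q′ [] h b′)
                         (++-assoc Q _ ws) (sym (+-suc b (length ws))))
             (enqueue-runs ws R′ (subst (_≤ suc B) (+-suc b (length ws)) room)))
    where
    open Represents R
    time : 5 + 17 + (22 * length ws + 5) ≡ 22 * suc (length ws) + 5
    time = trans (sym (+-assoc 22 (22 * length ws) 5)) (cong (_+ 5) (sym (*-suc 22 (length ws))))

    b≤B : b ≤ B
    b≤B = ≤-trans (m≤m+n b _) (≤-pred (subst (_≤ suc B) (+-suc b (length ws)) room))

    body : Runs _ _ 17 (λ s′ → Represents s′ (κ [ w ]≔ stamp b) σ (Q List.∷ʳ w) ws h (suc b))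
    body = ⇓pop r6 r6 eq
        ⨟→ ⇓:= (⇓inc-before r8 b≤B)
        ⨟→ ⇓write (⇓reg r3) keys ⇓var ⇓var
        ⨟→ done (⇓pushBack (⇓reg r5) ⇓var) (record
             { regs   = Regs-8 (suc b) (Regs-temporary 2 regs)
             ; arrays = Arrays-key w (stamp b) arrays
             ; lsts   = Lists-queue lsts′ (push-vertex w (Lists.queue lsts′))
             })
      where lsts′ = Lists-batch lsts ns≡ws

  module _ {i h b : ℕ} {σ : Vec (Fin n) i} {Q : List (Fin n)} where

    private
      Scanning : Fin n → ℕ → Fin n → (pre rest : List Node) → State → Keys → List (Fin n) → Set
      Scanning v k w pre rest s κ W =
        Represents s κ σ Q W h b × reg s 11 ≡ node (toℕ v) k × reg s 12 ≡ vertex w ×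
        lists s (toℕ v) ≡ pre ++ (k , vertex w) ∷ rest

    touch-runs : ∀ {v k w pre rest s κ W} → b ≤ B → Scanning v k w pre rest s κ W →
      Runs s (cond (isNil (var 3 at var 12)) (write (var 3) (var 12) (inc (var 8))) skip) 10
           (λ s′ → Scanning v k w pre rest s′ (κ [ w ]≔ touch b (lookup κ w)) W)
    touch-runs {v} {k} {w} {pre} {rest} {s} {κ} {W} b≤B I@(R , 11≡ , 12≡ , split) = by-key (lookup κ w) refl
      where
      open Represents R

      test : ∀ {c} → lookup κ w ≡ c → s ⊢ isNil (var 3 at var 12) ⇓ᵗ null (encode c)
      test eq = ⇓isNil (subst (λ c → s ⊢ var 3 at var 12 ⇓ encode c) eq (⇓key w r3 keys 12≡))

      unchanged : ∀ {c} → lookup κ w ≡ c → Scanning v k w pre rest s (κ [ w ]≔ c) W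
      unchanged refl = subst (λ κ′ → Scanning v k w pre rest s κ′ W) (sym ([]≔-lookup κ w)) I

      by-key : ∀ c → lookup κ w ≡ c → Runs s _ 10 (λ s′ → Scanning v k w pre rest s′ (κ [ w ]≔ touch b c) W)
      by-key unlabelled eq = cond-true (test eq)
        (done (⇓write (⇓reg r3) keys (⇓reg 12≡) (⇓inc-before r8 b≤B))
              (record { regs = regs ; arrays = Arrays-key w (stamp b) arrays ; lsts = lsts } ,
               11≡ , 12≡ , split))
      by-key numbered  eq = within (m≤m+n 6 4) (cond-false (test eq) (done ⇓skip (unchanged eq)))
      by-key (stamp _) eq = within (m≤m+n 6 4) (cond-false (test eq) (done ⇓skip (unchanged eq)))

    gather-runs : ∀ {v k w pre rest s κ W} → lookup κ w ≢ unlabelled → Scanning v k w pre rest s κ W →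
      Runs s (cond (lit (+ 0) ≤ᵗ var 3 at var 12) (pushBack (var 6) (var 12)) skip) 9
           (λ s′ → Scanning v k w pre rest s′ κ (W ++ active κ (w ∷ [])))
    gather-runs {v} {k} {w} {pre} {rest} {s} {κ} {W} known I@(R , 11≡ , 12≡ , split) = by-key (lookup κ w) refl
      where
      open Represents R

      key⇓ : ∀ {c} → lookup κ w ≡ c → s ⊢ var 3 at var 12 ⇓ encode c
      key⇓ eq = subst (λ c → s ⊢ var 3 at var 12 ⇓ encode c) eq (⇓key w r3 keys 12≡)

      by-key : ∀ c → lookup κ w ≡ c → Runs s _ 9 (λ s′ → Scanning v k w pre rest s′ κ (W ++ active κ (w ∷ [])))
      by-key unlabelled eq = contradiction eq known
      by-key numbered   eq = within (m≤m+n 7 2) (cond-false (⇓≤ (⇓lit z≤n) (key⇓ eq)) (done ⇓skip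
        (subst (Scanning v k w pre rest s κ) (sym (trans (cong (W ++_) rejected) (++-identityʳ W))) I)))
        where
        rejected : active κ (w ∷ []) ≡ []
        rejected = filter-reject (λ x → ¬? (numbered? (lookup κ x))) λ live → live eq
      by-key (stamp t)  eq = cond-true (⇓≤ (⇓lit z≤n) (key⇓ eq)) (done (⇓pushBack (⇓reg r6) (⇓reg 12≡))
        ( record { regs = regs ; arrays = arrays ; lsts = Lists-batch lsts pushed }
        , 11≡ , 12≡ , trans (update-≢ (lists s) (3 + n) (toℕ≢ {3} v)) split))
        where
        accepted : active κ (w ∷ []) ≡ w ∷ []
        accepted = filter-accept (λ x → ¬? (numbered? (lookup κ x))) λ num → stamp≢numbered (trans (sym eq) num)
          where
          stamp≢numbered : stamp t ≢ numbered
          stamp≢numbered ()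
        pushed : map proj₂ (lists s (3 + n) List.∷ʳ (State.fresh s , vertex w)) ≡
                 map vertex (W ++ active κ (w ∷ []))
        pushed = trans (push-vertex w batch) (cong (λ ws → map vertex (W ++ ws)) (sym accepted))

    -- A turn costs 4 for the test and 25 for the body with both conditionals padded to their dearer
    -- branch. As long as a neighbour is left, the bound makes the provisional key `b`
    -- representable.
    collect-runs : ∀ v r {s κ W pre rest} → Represents s κ σ Q W h b →
      reg s 11 ≡ nodeRef (toℕ v) (List.head rest) → lists s (toℕ v) ≡ pre ++ rest →
      map proj₂ rest ≡ map vertex r → b + length r ≤ suc B →
      Runs s collect (29 * length r + 4) (λ s′ → Represents s′ (mark b κ r) σ Q (W ++ active κ r) h b)
    collect-runs v [] {s} {κ} {W} {rest = []} R 11≡ _ _ _ =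
      done (⇓while-false (⇓not (⇓isNil (⇓reg 11≡))))
           (subst (λ W → Represents s κ σ Q W h b) (sym (++-identityʳ W)) R)
    collect-runs v (w ∷ r) {s} {κ} {W} {pre} {rest} R 11≡ split rest≡r room with uncons rest≡r
    ... | k , rest′ , refl , rest′≡r = within (≤-reflexive time)
        (iterate (⇓not (⇓isNil (⇓reg 11≡))) body λ { {s′} (R′ , 11≡′ , split′) →
          post (λ {s″} → subst (λ W → Represents s″ (mark b κ′ r) σ Q W h b) gathered)
               (collect-runs v r R′ 11≡′ split′ rest′≡r (≤-trans (+-monoʳ-≤ b (n≤1+n _)) room)) })
      where
      κ′ : Keys
      κ′ = κ [ w ]≔ touch b (lookup κ w)

      time : 4 + 25 + (29 * length r + 4) ≡ 29 * suc (length r) + 4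
      time = trans (sym (+-assoc 29 (29 * length r) 4)) (cong (_+ 4) (sym (*-suc 29 (length r))))

      b≤B : b ≤ B
      b≤B = ≤-trans (m≤m+n b _) (≤-pred (subst (_≤ suc B) (+-suc b (length r)) room))

      gathered : (W ++ active κ′ (w ∷ [])) ++ active κ′ r ≡ W ++ active κ (w ∷ r)
      gathered = begin
        (W ++ active κ′ (w ∷ [])) ++ active κ′ r  ≡⟨ ++-assoc W _ _ ⟩
        W ++ (active κ′ (w ∷ []) ++ active κ′ r)
          ≡⟨ cong (W ++_) (filter-++ (λ x → ¬? (numbered? (lookup κ′ x))) (w ∷ []) r) ⟨
        W ++ active κ′ (w ∷ r)                    ≡⟨ cong (W ++_) (active-touch b κ w (w ∷ r)) ⟩
        W ++ active κ (w ∷ r)                     ∎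
        where open ≡-Reasoning

      known : lookup κ′ w ≢ unlabelled
      known eq = touch-known b (lookup κ w) (trans (sym (lookup∘update w κ _)) eq)

      body : Runs s _ 25 (λ s′ → Represents s′ κ′ σ Q (W ++ active κ′ (w ∷ [])) h b ×
                                 reg s′ 11 ≡ nodeRef (toℕ v) (List.head rest′) ×
                                 lists s′ (toℕ v) ≡ (pre ++ (k , vertex w) ∷ []) ++ rest′)
      body = ⇓:= (⇓value (⇓reg 11≡) split) ⨟→
        seq (touch-runs b≤B
              ( Represents-temporary 2 R
              , 11≡ , refl , split)) λ I →
        seq (gather-runs known I) λ (R′ , 11≡′ , _ , split′) →
        done (⇓:= (⇓next (⇓reg 11≡′) split′))
          ( Represents-temporary 1 R′
          , refl , trans split′ (sym (++-assoc pre _ rest′)))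
        where open Represents R

    -- The stamps are demanded because the key expression must evaluate to an integer at every node.
    sort-runs : ∀ {s κ W} → Represents s κ σ Q W h b → (∀ {w} → w ∈ W → ∃[ t ] lookup κ w ≡ stamp t) →
      Runs s (sort (var 6) 12 (var 3 at var 12)) (2 + sortTime (length W))
        (λ s′ → ∃[ ws ] (ws ↭ W × AllPairs (Earlier κ) ws × Represents s′ κ σ Q ws h b))
    sort-runs {s} {κ} {W} R stamped with sortBy-vertices κ (Represents.batch R)
    ... | ws , eq , ws↭W , sorted =
      within (≤-reflexive (cong (λ k → 2 + sortTime k) length≡))
        (done (⇓sort (⇓reg r6) (keyOf κ) key⇓)
              (ws , ws↭W , sorted , record { regs = regs ; arrays = arrays ; lsts = Lists-batch lsts eq }))
      where
      open Represents R

      length≡ : length (lists s (3 + n)) ≡ length W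
      length≡ = trans (sym (length-map proj₂ (lists s (3 + n)))) (trans (cong length batch) (length-map vertex W))

      key⇓ : ∀ {k u} → (k , u) ∈ lists s (3 + n) → setReg 12 u s ⊢ var 3 at var 12 ⇓ int (keyOf κ u)
      key⇓ {u = u} ku∈ with ∈-map⁻ vertex (subst (u ∈_) batch (∈-map⁺ proj₂ ku∈))
      ... | w , w∈W , refl with stamped w∈W
      ...   | t , κw = subst (setReg 12 (vertex w) s ⊢ var 3 at var 12 ⇓_) same (⇓key w r3 keys refl)
        where
        same : encode (lookup κ w) ≡ int (keyOf κ (vertex w))
        same = trans (cong encode κw) (cong int (sym (trans (keyOf-vertex κ w) (cong rank κw))))

  n≤B : n ≤ B
  n≤B = m≤m⊔n n _

  2m≤B : 2 * #edges ≤ B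
  2m≤B = m≤n⊔m n _

  1≤B : 1 ≤ B
  1≤B = ≤-trans (n≢0⇒n>0 n≢0) n≤B

  visitTime : ℕ → ℕ
  visitTime d = 16 + ((29 * d + 4) + ((2 + sortTime d) + (22 * d + 5)))

  visit-runs : ∀ {s κ i v Q h b} {σ : Vec (Fin n) i} → Represents s κ σ Q [] h b →
    reg s 10 ≡ vertex v → i < n → b + degree G A v ≤ suc B →
    let κ₁ = κ [ v ]≔ numbered ; κ₂ = mark b κ₁ (nbrs v) in
    Runs s visit (visitTime (degree G A v)) (λ s′ → ∃[ ws ] (ws ↭ active κ₁ (nbrs v) ×
      AllPairs (Earlier κ₂) ws × Represents s′ (stampAll b κ₂ ws) (σ ∷ʳ v) (Q ++ ws) [] h (b + length ws)))
  visit-runs {s} {κ} {i} {v} {Q} {h} {b} {σ} R 10≡ i<n room =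
    ⇓write (⇓reg r3) keys (⇓reg 10≡) (⇓lit 1≤B) ⨟→
    ⇓write (⇓reg r4) (Arrays.output arrays₁) (⇓reg r9′) (⇓reg 10≡) ⨟→
    ⇓:= (⇓inc (⇓reg r9) (≤-trans i<n n≤B)) ⨟→
    ⇓:= (⇓first adjacency⇓) ⨟→
    seq (collect-runs {σ = σ ∷ʳ v} {Q} v (nbrs v) {pre = []}
          (record { regs = Regs-temporary 1 (Regs-9 (suc i) regs) ; arrays = arrays₂ ; lsts = lsts })
          refl refl (neighbours v) room) λ R₁ →
    seq (within (+-monoʳ-≤ 2 (sortTime-mono length-W≤)) (sort-runs R₁ stamped)) λ (ws , ws↭ , sorted , R₂) →
    let ws≤ = ≤-trans (≤-reflexive (↭-length ws↭)) length-W≤ in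
    within (+-monoˡ-≤ 5 (*-monoʳ-≤ 22 ws≤))
      (post (λ R₃ → ws , ws↭ , sorted , R₃)
        (enqueue-runs ws R₂ (≤-trans (+-monoʳ-≤ b ws≤) room)))
    where
    open Represents R

    κ₁ : Keys
    κ₁ = κ [ v ]≔ numbered

    arrays₁ = Arrays-key v numbered arrays

    arrays₂ = Arrays-output v arrays₁ (toℕ-fromℕ< i<n)

    r9′ : reg s 9 ≡ int (+ toℕ (fromℕ< i<n))
    r9′ = trans r9 (cong (λ k → int (+ k)) (sym (toℕ-fromℕ< i<n)))

    s₃ : State
    s₃ = setReg 9 (int (+ suc i))
          (setArr (1 + n) (n , Arrays.out arrays₁ [ fromℕ< i<n ]≔ vertex v)
          (setArr n (n , Vec.map encode κ [ v ]≔ encode numbered) s))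

    adjacency⇓ : s₃ ⊢ var 0 at var 10 ⇓ list (toℕ v)
    adjacency⇓ = subst (s₃ ⊢ var 0 at var 10 ⇓_) (lookup∘tabulate (list ∘ toℕ) v)
      (⇓at (⇓reg r0) (Arrays.adjacency arrays₂) (⇓reg 10≡))

    sortTime-mono : ∀ {j k} → j ≤ k → sortTime j ≤ sortTime k
    sortTime-mono j≤k = *-monoʳ-≤ 3 (*-mono-≤ j≤k (⌈log₂⌉-mono-≤ j≤k))

    length-W≤ : length (active κ₁ (nbrs v)) ≤ degree G A v
    length-W≤ = length-filter (λ w → ¬? (numbered? (lookup κ₁ w))) (nbrs v)

    stamped : ∀ {w} → w ∈ active κ₁ (nbrs v) → ∃[ t ] lookup (mark b κ₁ (nbrs v)) w ≡ stamp t
    stamped w∈ with ∈-filter⁻ (λ w → ¬? (numbered? (lookup κ₁ w))) {xs = nbrs v} w∈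
    ... | w∈nbrs , live with touch-live b live
    ...   | t , eq = t , trans (mark-∈ {b = b} {κ₁} w∈nbrs) eq

-- Each of the d neighbours is charged 29 for collect, 22 for enqueueBatch and
-- another 22 for the removal of its new entry from the queue.
visitCost : ℕ → ℕ
visitCost d = 27 + (73 * d + sortTime d)

-- The main loop and the whole program.

module Search {n} (G : Graph n) (A : AdjacencyLists G) where
  open Graph G
  open AdjacencyLists A
  open Correctness G A
  open Machine G A
  open Execution B

  cost : Fin n → ℕ
  cost v = visitCost (degree G A v)

  Final : State → Set
  Final s = ∃[ i ] ∃[ σ ] ∃[ κ ] ∃[ h ] ∃[ b ] ∃[ ℓ ]
    (Represents s κ {i} σ [] [] h b × Invariant κ [] h σ ℓ)

  ⇓≡-true : ∀ {s e e′ z} → s ⊢ e ⇓ int z → s ⊢ e′ ⇓ int z → s ⊢ e ≡ᵗ e′ ⇓ᵗ true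
  ⇓≡-true {s} {e} {e′} {z} e⇓ e′⇓ = subst (s ⊢ e ≡ᵗ e′ ⇓ᵗ_) (dec-true (z ℤ.≟ z) refl) (⇓≡ e⇓ e′⇓)

  ⇓≡-false : ∀ {s e e′ y z} → y ≢ z → s ⊢ e ⇓ int y → s ⊢ e′ ⇓ int z → s ⊢ e ≡ᵗ e′ ⇓ᵗ false
  ⇓≡-false {s} {e} {e′} {y} {z} y≢z e⇓ e′⇓ = subst (s ⊢ e ≡ᵗ e′ ⇓ᵗ_) (dec-false (y ℤ.≟ z) y≢z) (⇓≡ e⇓ e′⇓)

  -- The queue may grow, so the induction is on a bound for |Q| plus the remaining degrees: each
  -- turn removes one entry, and a visit trades the degree of `v` for at most as many new ones.
  search-runs : ∀ fuel {s κ i Q h ℓ} {σ : Vec (Fin n) i} →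
    length Q + remaining (degree G A) κ ≤ fuel →
    Represents s κ σ Q [] h (h + length Q) → Invariant κ Q h σ ℓ →
    Runs s search (22 * length Q + remaining cost κ + 5) Final
  search-runs fuel {κ = κ} {Q = []} _ R I = within (m≤n+m 5 _)
    (done (⇓while-false (⇓nonempty-false r5 (uncons-[] queue))) (_ , _ , _ , _ , _ , _ , R , I))
    where open Represents R
  search-runs (suc fuel) {s} {κ} {i} {v ∷ Q} {h} {ℓ} {σ} (s≤s enough) R I with uncons (Represents.queue R)
  ... | k , ns , eq , ns≡Q = by-key (lookup κ v) refl
    where
    open Represents R
    open Invariant I using (room; known)

    b : ℕ
    b = suc h + length Q

    room′ : b + remaining (degree G A) κ ≤ suc (2 * #edges)
    room′ = subst (λ b → b + remaining (degree G A) κ ≤ suc (2 * #edges)) (+-suc h (length Q)) room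

    -- The queue is nonempty, so of the at most 2m + 1 entries at least one has an index from `h`
    -- on.
    h≤B : h ≤ B
    h≤B = ≤-trans (≤-trans (m≤m+n h _) (≤-trans (m≤m+n (h + length Q) _) (≤-pred room′))) 2m≤B

    s₁ : State
    s₁ = setReg 7 (int (+ h)) (setList (2 + n) ns (setReg 10 (vertex v) s))

    R₁ : Represents s₁ κ σ Q [] (suc h) b
    R₁ = record
      { regs   = Regs-7 (suc h) (Regs-temporary 0 (subst (λ b → Regs (reg s) h b i) (+-suc h (length Q)) regs))
      ; arrays = arrays
      ; lsts   = Lists-queue lsts ns≡Q
      }

    step : ∀ {T T′} {P : State → Set} →
      Runs s₁ (cond (var 3 at var 10 ≡ᵗ var 7) visit skip) T P → (∀ {s′} → P s′ → Runs s′ search T′ Final) →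
      Runs s search (5 + (7 + (3 + T)) + T′) Final
    step branch = iterate (⇓nonempty-true r5 eq)
      (⇓pop r5 r5 eq ⨟→ ⇓:= (⇓inc-before r7 h≤B) ⨟→ branch)

    key⇓ : ∀ {c} → lookup κ v ≡ c → s₁ ⊢ var 3 at var 10 ⇓ encode c
    key⇓ κv = subst (λ c → s₁ ⊢ var 3 at var 10 ⇓ encode c) κv (⇓key v r3 keys refl)

    skipping : s₁ ⊢ var 3 at var 10 ≡ᵗ var 7 ⇓ᵗ false → lookup κ v ≢ stamp h →
               Runs s search (22 * length (v ∷ Q) + remaining cost κ + 5) Final
    skipping test κv≢h = within (≤-reflexive (time (length Q) (remaining cost κ)))
      (step (cond-false test (done ⇓skip R₁)) λ R′ →
        search-runs fuel enough R′ (skip-preserves I κv≢h))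
      where
      time : ∀ q r → 22 + (22 * q + r + 5) ≡ 22 * suc q + r + 5
      time = solve-∀

    visiting : lookup κ v ≡ stamp h → Runs s search (22 * length (v ∷ Q) + remaining cost κ + 5) Final
    visiting κv = within time (step
      (cond-true (⇓≡-true (key⇓ κv) ⇓var)
        (visit-runs R₁ refl unfinished
          (≤-trans (subst (b + d ≤_) (+-assoc b d _) (m≤m+n (b + d) _))
                   (≤-trans (≤-reflexive (cong (λ r → b + r) (sym (remaining-chosen (degree G A)))))
                            (≤-trans room′ (s≤s 2m≤B))))))
      λ (ws , ws↭ , sorted , R′) →
        within (+-monoˡ-≤ 5 (+-mono-≤ (*-monoʳ-≤ 22 (length-Q++ws≤ ws↭ sorted)) (≤-reflexive (same-cost ws↭ sorted))))
          (search-runs fuel (enough′ ws↭ sorted)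
            (subst (Represents _ _ _ _ _ _)
              (trans (+-assoc (suc h) (length Q) _) (cong (λ q → suc h + q) (sym (length-++ Q)))) R′)
            (visit-preserves ws↭ sorted)))
      where
      open Visit I κv hiding (b)

      d : ℕ
      d = degree G A v

      module _ {ws} (ws↭ : ws ↭ active κ₁ (nbrs v)) (sorted : AllPairs (Earlier κ₂) ws) where

        length-Q++ws≤ : length (Q ++ ws) ≤ length Q + d
        length-Q++ws≤ = ≤-trans (≤-reflexive (length-++ Q)) (+-monoʳ-≤ (length Q) (length-ws≤ ws↭ sorted))

        same-cost : remaining cost (κ₃ ws↭ sorted) ≡ remaining cost κ₁
        same-cost = +-cancelˡ-≡ (cost v) _ _
          (trans (sym (remaining-visit ws↭ sorted cost)) (remaining-chosen cost))

        enough′ : length (Q ++ ws) + remaining (degree G A) (κ₃ ws↭ sorted) ≤ fuel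
        enough′ = begin
          length (Q ++ ws) + remaining (degree G A) (κ₃ ws↭ sorted) ≤⟨ +-monoˡ-≤ _ length-Q++ws≤ ⟩
          length Q + d + remaining (degree G A) (κ₃ ws↭ sorted)     ≡⟨ +-assoc (length Q) d _ ⟩
          length Q + (d + remaining (degree G A) (κ₃ ws↭ sorted))
            ≡⟨ cong (λ r → length Q + r) (remaining-visit ws↭ sorted (degree G A)) ⟨
          length Q + remaining (degree G A) κ                       ≤⟨ enough ⟩
          fuel                                                      ∎
          where open ≤-Reasoning

      time : 5 + (7 + (3 + (6 + visitTime d))) + (22 * (length Q + d) + remaining cost κ₁ + 5)
             ≤ 22 * suc (length Q) + remaining cost κ + 5
      time = begin
        5 + (7 + (3 + (6 + visitTime d))) + (22 * (length Q + d) + remaining cost κ₁ + 5)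
          -- A stale entry costs 22, including 1 for `skip`; a visit does not execute `skip` and so
          -- has one unit to spare.
          ≤⟨ n≤1+n _ ⟩
        suc (5 + (7 + (3 + (6 + visitTime d))) + (22 * (length Q + d) + remaining cost κ₁ + 5))
          ≡⟨ total d (length Q) (remaining cost κ₁) (sortTime d) ⟩
        22 * suc (length Q) + (cost v + remaining cost κ₁) + 5
          ≡⟨ cong (λ r → 22 * suc (length Q) + r + 5) (remaining-chosen cost) ⟨
        22 * suc (length Q) + remaining cost κ + 5 ∎
        where
        open ≤-Reasoning
        total : ∀ d q r l →
          suc (5 + (7 + (3 + (6 + (16 + ((29 * d + 4) + ((2 + l) + (22 * d + 5))))))) + (22 * (q + d) + r + 5))
          ≡ 22 * suc q + (27 + (73 * d + l) + r) + 5
        total = solve-∀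

    by-key : ∀ c → lookup κ v ≡ c → Runs s search (22 * length (v ∷ Q) + remaining cost κ + 5) Final
    -- Here the test would compare nil with an integer, a fault; `known` excludes it.
    by-key unlabelled κv = contradiction κv (known (here refl))
    by-key numbered   κv = skipping (⇓≡-false (λ ()) (key⇓ κv) ⇓var) λ κv≡h → numbered≢stamp (trans (sym κv) κv≡h)
      where
      numbered≢stamp : numbered ≢ stamp h
      numbered≢stamp ()
    by-key (stamp t)  κv with t ≟ h
    ... | yes refl = visiting κv
    ... | no t≢h   = skipping (⇓≡-false (t≢h ∘ ℤ.+-injective) (key⇓ κv) ⇓var)
                              λ κv≡h → t≢h (stamp-injective (trans (sym κv) κv≡h))

  private
    map-proj₂-zip : ∀ (ks : List ℕ) (vs : List Val) → length ks ≡ length vs → map proj₂ (List.zip ks vs) ≡ vs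
    map-proj₂-zip []       []       _  = refl
    map-proj₂-zip (_ ∷ ks) (v ∷ vs) eq = cong (v ∷_) (map-proj₂-zip ks vs (suc-injective eq))

    input-neighbours : ∀ v → map proj₂ (lists (input G A) (toℕ v)) ≡ map vertex (nbrs v)
    input-neighbours v with toℕ v <? n
    ... | no v≮n  = contradiction (toℕ<n v) v≮n
    ... | yes v<n rewrite fromℕ<-toℕ v v<n =
      map-proj₂-zip (List.upTo (degree G A v)) (map vertex (nbrs v))
        (trans (length-upTo (degree G A v)) (sym (length-map vertex (nbrs v))))

  initial-lists : Lists ((lists (input G A) [ 2 + n ↦ [] ]) [ 3 + n ↦ [] ]) [] []
  initial-lists = record
    { neighbours = λ v → trans (cong (map proj₂)
        (trans (update-≢ l₁ (3 + n) (toℕ≢ {3} v)) (update-≢ l₀ (2 + n) (toℕ≢ {2} v)))) (input-neighbours v)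
    ; queue = cong (map proj₂) (trans (update-≢ l₁ (3 + n) (1+n≢n ∘ sym)) (update-≡ l₀ (2 + n)))
    ; batch = cong (map proj₂) (update-≡ l₁ (3 + n))
    }
    where
    l₀ l₁ : ℕ → List Node
    l₀ = lists (input G A)
    l₁ = l₀ [ 2 + n ↦ [] ]

  initial-arrays : Arrays ((arrs (input G A) [ n ↦ (n , Vec.replicate n nil) ]) [ 1 + n ↦ (n , Vec.replicate n nil) ])
                          (Vec.replicate n unlabelled) Vec.[]
  initial-arrays = record
    { adjacency = update-≢ a₀ n (n≢0 ∘ sym)
    ; keys      = trans (update-≢ a₁ (1 + n) (1+n≢n ∘ sym)) (trans (update-≡ a₀ n)
                    (cong (n ,_) (sym (map-replicate encode unlabelled n))))
    ; output    = update-≡ a₁ (1 + n)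
    ; prefix    = λ ()
    }
    where
    a₀ a₁ : ℕ → Σ ℕ (Vec Val)
    a₀ = arrs (input G A)
    a₁ = a₀ [ n ↦ (n , Vec.replicate n nil) ]

  prefix-complete : ∀ {σ : Vec (Fin n) n} {out} → Prefix σ out → out ≡ Vec.map vertex σ
  prefix-complete {σ} {out} prefix = begin
    out                                        ≡⟨ tabulate∘lookup out ⟨
    Vec.tabulate (lookup out)
      ≡⟨ tabulate-cong (λ k → trans (prefix k k refl) (sym (lookup-map k vertex σ))) ⟩
    Vec.tabulate (lookup (Vec.map vertex σ))   ≡⟨ tabulate∘lookup (Vec.map vertex σ) ⟩
    Vec.map vertex σ                           ∎
    where open ≡-Reasoning

  -- 2n is for creating the two arrays. The 50 consists of 21 for the rest of the initialization, 22
  -- for the entry of the source, 5 for the last test and 2 for the final assignment.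
  program-runs : Connected G → Runs (input G A) program (50 + (2 * n + sum cost))
    (λ s → ∃[ σ ] (Output σ s × LexDOWN.IsOrdering G σ))
  program-runs connected = within (≤-reflexive time)
    ( ⇓newArray ⇓var ⇓nil
    ⨟→ ⇓newArray ⇓var ⇓nil
    ⨟→ ⇓newList
    ⨟→ ⇓newList
    ⨟→ ⇓:= (⇓lit 1≤B)
    ⨟→ ⇓:= (⇓lit z≤n)
    ⨟→ ⇓:= (⇓lit z≤n)
    ⨟→ ⇓write ⇓var (Arrays.keys initial-arrays) ⇓var (⇓lit z≤n)
    ⨟→ ⇓pushBack ⇓var ⇓var
    ⨟→ seq (search-runs _ ≤-refl initial-represents initial-invariant)
         λ (i , σ , κ , h , b , ℓ , R , I) → done (⇓:= ⇓var) (result σ R I (complete connected I)))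
    where
    initial-represents : Represents _ initialKeys Vec.[] (source ∷ []) [] 0 1
    initial-represents = record
      { regs   = record { r0 = refl ; r3 = refl ; r4 = refl ; r5 = refl
                        ; r6 = refl ; r7 = refl ; r8 = refl ; r9 = refl }
      ; arrays = Arrays-key source (stamp 0) initial-arrays
      ; lsts   = Lists-queue initial-lists (push-vertex source (Lists.queue initial-lists))
      }

    result : ∀ {s i κ h b ℓ} (σ : Vec (Fin n) i) → Represents s κ σ [] [] h b → Invariant κ [] h σ ℓ → i ≡ n →
             ∃[ σ ] (Output σ (setReg 0 (reg s 4) s) × LexDOWN.IsOrdering G σ)
    result σ R I refl =
      σ , (1 + n , r4 , trans output (cong (n ,_) (prefix-complete {σ} prefix))) , (_ , Invariant.run I)
      where open Represents R

    time : (3 + n) + ((3 + n) + (1 + (1 + (2 + (2 + (2 + (4 + (3 + (22 * 1 + remaining cost initialKeys + 5 + 2)))))))))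
           ≡ 50 + (2 * n + sum cost)
    time = trans (cong (λ r → (3 + n) + ((3 + n) + (1 + (1 + (2 + (2 + (2 + (4 + (3 + (22 * 1 + r + 5 + 2))))))))))
                       (remaining-initial cost))
                 (total n (sum cost))
      where
      total : ∀ n r → (3 + n) + ((3 + n) + (1 + (1 + (2 + (2 + (2 + (4 + (3 + (22 * 1 + r + 5 + 2)))))))))
                      ≡ 50 + (2 * n + r)
      total = solve-∀

-- Summing up the time.

sum-affine : ∀ {k} a b (f : Fin k → ℕ) → sum (λ i → a + b * f i) ≡ k * a + b * sum f
sum-affine {zero}  a b f = sym (*-zeroʳ b)
sum-affine {suc k} a b f = trans (cong (λ s → a + b * f zero + s) (sum-affine a b (f ∘ suc)))
                                 (rearrange a (f zero) (k * a) b (sum (f ∘ suc)))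
  where
  rearrange : ∀ a z y b s → a + b * z + (y + b * s) ≡ a + y + b * (z + s)
  rearrange = solve-∀

term-≤-sum : ∀ {k} (f : Fin k → ℕ) i → f i ≤ sum f
term-≤-sum f zero    = m≤m+n (f zero) _
term-≤-sum f (suc i) = ≤-trans (term-≤-sum (f ∘ suc) i) (m≤n+m _ (f zero))

-- From m = 2 on the logarithm is at least 1; for m = 1 it vanishes, and n pays.
m≤n+m⌊log₂m⌋ : ∀ {n} m → 1 ≤ n → m ≤ n + m * ⌊log₂ m ⌋
m≤n+m⌊log₂m⌋ zero          _   = z≤n
m≤n+m⌊log₂m⌋ (suc zero)    1≤n = ≤-trans 1≤n (m≤m+n _ _)
m≤n+m⌊log₂m⌋ (suc (suc m)) _   = ≤-trans (≤-trans (≤-reflexive (sym (*-identityʳ (2 + m))))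
  (*-monoʳ-≤ (2 + m) (⌊log₂⌋-mono-≤ {2} {2 + m} (s≤s (s≤s z≤n))))) (m≤n+m _ _)

2m⌈log₂2m⌉≤ : ∀ m → 2 * m * ⌈log₂ (2 * m) ⌉ ≤ 4 * m + 2 * (m * ⌊log₂ m ⌋)
2m⌈log₂2m⌉≤ zero      = z≤n
2m⌈log₂2m⌉≤ m@(suc _) = begin
  2 * m * ⌈log₂ (2 * m) ⌉       ≡⟨ cong (λ l → 2 * m * l) (⌈log₂2*n⌉≡1+⌈log₂n⌉ m) ⟩
  2 * m * suc ⌈log₂ m ⌉         ≤⟨ *-monoʳ-≤ (2 * m) (s≤s (⌈log₂⌉≤1+⌊log₂⌋ m)) ⟩
  2 * m * (2 + ⌊log₂ m ⌋)       ≡⟨ expand m ⌊log₂ m ⌋ ⟩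
  4 * m + 2 * (m * ⌊log₂ m ⌋)   ∎
  where
  open ≤-Reasoning
  expand : ∀ m l → 2 * m * (2 + l) ≡ 4 * m + 2 * (m * l)
  expand = solve-∀

module _ {n} (G : Graph n) (A : AdjacencyLists G) where
  open Graph G

  private
    m S : ℕ
    m = #edges
    S = sum (degree G A)

  -- Every degree is at most 2m, so one logarithm `C` serves for all vertices; the cost becomes
  -- affine in the degree and the handshake lemma applies.
  sum-cost-≤ : sum (Search.cost G A) ≤ 27 * n + 158 * m + 6 * (m * ⌊log₂ m ⌋)
  sum-cost-≤ = begin
    sum (Search.cost G A)                                 ≤⟨ sum-mono-≤ cost≤ ⟩
    sum (λ v → 27 + (73 + 3 * C) * degree G A v)          ≡⟨ sum-affine 27 (73 + 3 * C) (degree G A) ⟩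
    n * 27 + (73 + 3 * C) * S                             ≤⟨ +-monoʳ-≤ (n * 27) (*-monoʳ-≤ (73 + 3 * C) (handshake G A)) ⟩
    n * 27 + (73 + 3 * C) * (2 * m)                       ≡⟨ expand n C m ⟩
    27 * n + 146 * m + 3 * (2 * m * C)                    ≤⟨ +-monoʳ-≤ (27 * n + 146 * m) (*-monoʳ-≤ 3 (2m⌈log₂2m⌉≤ m)) ⟩
    27 * n + 146 * m + 3 * (4 * m + 2 * (m * ⌊log₂ m ⌋))  ≡⟨ collect-terms n m (m * ⌊log₂ m ⌋) ⟩
    27 * n + 158 * m + 6 * (m * ⌊log₂ m ⌋)                ∎
    where
    open ≤-Reasoning
    C : ℕ
    C = ⌈log₂ (2 * m) ⌉

    cost≤ : ∀ v → visitCost (degree G A v) ≤ 27 + (73 + 3 * C) * degree G A v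
    cost≤ v = begin
      27 + (73 * d + 3 * (d * ⌈log₂ d ⌉))
        ≤⟨ +-monoʳ-≤ 27 (+-monoʳ-≤ (73 * d) (*-monoʳ-≤ 3 (*-monoʳ-≤ d (⌈log₂⌉-mono-≤ d≤2m)))) ⟩
      27 + (73 * d + 3 * (d * C))          ≡⟨ factor d C ⟩
      27 + (73 + 3 * C) * d                ∎
      where
      d : ℕ
      d = degree G A v
      d≤2m : d ≤ 2 * m
      d≤2m = ≤-trans (term-≤-sum (degree G A) v) (handshake G A)
      factor : ∀ d C → 27 + (73 * d + 3 * (d * C)) ≡ 27 + (73 + 3 * C) * d
      factor = solve-∀

    expand : ∀ n C m → n * 27 + (73 + 3 * C) * (2 * m) ≡ 27 * n + 146 * m + 3 * (2 * m * C)
    expand = solve-∀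

    collect-terms : ∀ n m l → 27 * n + 146 * m + 3 * (4 * m + 2 * l) ≡ 27 * n + 158 * m + 6 * l
    collect-terms = solve-∀

  total-≤ : 50 + (2 * n + sum (Search.cost G A)) ≤ 237 * (n + m * ⌊log₂ m ⌋)
  total-≤ = begin
    50 + (2 * n + sum (Search.cost G A))                    ≤⟨ +-mono-≤ (*-monoʳ-≤ 50 1≤n) (+-monoʳ-≤ (2 * n) sum-cost-≤) ⟩
    50 * n + (2 * n + (27 * n + 158 * m + 6 * l))           ≡⟨ regroup n m l ⟩
    79 * n + 6 * l + 158 * m                                ≤⟨ +-monoʳ-≤ (79 * n + 6 * l) (*-monoʳ-≤ 158 (m≤n+m⌊log₂m⌋ m 1≤n)) ⟩
    -- n has the coefficient 79 + 158 = 237 but l only 164; adding 73 l leaves a single constant.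
    79 * n + 6 * l + 158 * (n + l)                          ≤⟨ m≤m+n _ (73 * l) ⟩
    79 * n + 6 * l + 158 * (n + l) + 73 * l                 ≡⟨ gather n l ⟩
    237 * (n + l)                                           ∎
    where
    open ≤-Reasoning
    l : ℕ
    l = m * ⌊log₂ m ⌋
    1≤n : 1 ≤ n
    1≤n = n≢0⇒n>0 (Machine.n≢0 G A)
    regroup : ∀ n m l → 50 * n + (2 * n + (27 * n + 158 * m + 6 * l)) ≡ 79 * n + 6 * l + 158 * m
    regroup = solve-∀
    gather : ∀ n l → 79 * n + 6 * l + 158 * (n + l) + 73 * l ≡ 237 * (n + l)
    gather = solve-∀

theorem4p2 : ∃[ p ] ∃[ c ] (∀ {n} (G : Graph n) → Connected G → (A : AdjacencyLists G) →
    let m = Graph.#edges G in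
    ∃[ σ ] ∃[ t ] (Computes p G A σ t × LexDOWN.IsOrdering G σ × t ≤ c * (n + m * ⌊log₂ m ⌋)))
theorem4p2 = program , 237 , λ G connected A →
  let t , s , program⇓ , t≤ , σ , output , ordering = Search.program-runs G A connected
  in σ , t , (s , program⇓ , output) , ordering , ≤-trans t≤ (total-≤ G A)
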